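{- Let $\lambda/\mu$ be a skew partition that is connected and has no empty columns, and let $\nu$ be a partition that is representable with respect to $\lambda/\mu$. Then the map $\mathbf B:\operatorname{RPP}^{12}(\lambda/\mu;\nu)\to\operatorname{RPP}^{12}(\lambda/\mu;\nu)$ is the unique involution on $\operatorname{RPP}^{12}(\lambda/\mu;\nu)$ that interchanges the number of 1-pure columns with the number of 2-pure columns inside each irreducible component of $\nu$. (That is, $\mathbf B$ is the unique involution $f$ such that for every $T$ and every $0\le k\le r$, the numbers of 1-pure and of 2-pure columns of $f(T)$ among the columns $b_k,b_k+1,\ldots,a_{k+1}-1$ equal, respectively, the numbers of 2-pure and of 1-pure columns of $T$ among these columns.)
   Context: A partition $\lambda=(\lambda_1\ge\lambda_2\ge\cdots)$ is identified with its Young diagram $\{(i,j)\in\mathbb N_+^2\mid j\le\lambda_i\}$ ($i$ is the row, growing downwards; $j$ is the column). A skew partition $\lambda/\mu$ is a pair of partitions with $\mu\subseteq\lambda$, also identified with the set difference of the diagrams. "Connected" means connected as a subgraph of $\mathbb Z^2$, two cells being adjacent if they share an edge; "no empty columns" means each of the columns $1,\ldots,\lambda_1$ contains a cell of $\lambda/\mu$. 12-tables. A 12-table is a map $T:\lambda/\mu\to\{1,2\}$ weakly increasing down columns; a 12-rpp is a 12-table that is also weakly increasing from left to right along rows. A column is 1-pure (2-pure) if it is nonempty and all its entries are 1 (resp. 2), mixed if it contains both 1's and 2's. If column $k$ of $T$ is mixed, $\operatorname{sep}_kT$ is the smallest $r$ with $(r,k)\in\lambda/\mu$, $T(r,k)=2$.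 A 12-table is benign if the values $\operatorname{sep}_kT$, listed over all mixed columns $k$ in increasing order of $k$, are weakly decreasing. $\operatorname{flip}(T)$ is obtained from $T$ by making every 1-pure column 2-pure and every 2-pure column 1-pure, leaving other columns unchanged. A descent of $T$ is a $k\ge 1$ such that for some $r$ the cells $(r,k),(r,k+1)$ lie in $\lambda/\mu$ and $T(r,k)=2$, $T(r,k+1)=1$. If $k$ is a descent of a benign 12-table $P$, then exactly one of the following holds, and $\operatorname{res}_kP$ ("resolving $k$") is the benign 12-table differing from $P$ only in columns $k,k+1$ and defined by: (M1) column $k$ of $P$ mixed, column $k+1$ 1-pure: in $\operatorname{res}_kP$ column $k$ is 1-pure and column $k+1$ is mixed with $\operatorname{sep}_{k+1}(\operatorname{res}_kP)=\operatorname{sep}_kP$; (2M) column $k$ 2-pure, column $k+1$ mixed: in $\operatorname{res}_kP$ column $k$ is mixed with $\operatorname{sep}_k(\operatorname{res}_kP)=\operatorname{sep}_{k+1}P$ and column $k+1$ is 2-pure; (21) column $k$ 2-pure, column $k+1$ 1-pure: in $\operatorname{res}_kP$ column $k$ is 1-pure and column $k+1$ is 2-pure. For every benign 12-table $P$ there is a unique 12-rpp, denoted $\operatorname{norm}(P)$, obtainable from $P$ by a finite (possibly empty) sequence of descent resolutions. For a 12-rpp $T$ (which is always benign, as is $\operatorname{flip}(T)$), $\mathbf B(T):=\operatorname{norm}(\operatorname{flip}(T))$. Seplist. For a 12-rpp $T$, let $\{(i_1,j_1),\ldots,(i_s,j_s)\}$ with $j_1<\cdots<j_s$ be the set of all cells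 $(i,j)\in\lambda/\mu$ with $T(i,j)=1$, $(i+1,j)\in\lambda/\mu$, $T(i+1,j)=2$; then $i_1\ge\cdots\ge i_s$ and $\operatorname{seplist}(T):=(i_1,\ldots,i_s)$. $\operatorname{RPP}^{12}(\lambda/\mu;\nu)$ is the set of 12-rpps $T$ of shape $\lambda/\mu$ with $\operatorname{seplist}(T)=\nu$; $\mathbf B$ maps this set to itself. Irreducible components. $\operatorname{supp}(i)=\{j\mid (i,j),(i+1,j)\in\lambda/\mu\}=[\mu_i+1,\lambda_{i+1}]$. A partition $\nu=(i_1\ge\cdots\ge i_s>0)$ is admissible if $\operatorname{supp}(i_k)\ne\varnothing$ for all $k$. For integers $a\le b$, $\nu|_{\subseteq[a,b)}$ (resp. $\nu|_{\cap[a,b)}$) is the subpartition of those entries $i_k$ (with multiplicity) with $\operatorname{supp}(i_k)\subseteq[a,b)$ (resp. $\operatorname{supp}(i_k)\cap[a,b)\ne\varnothing$); $\#$ denotes number of entries. An admissible $\nu$ is representable if $\#\nu|_{\subseteq[a,b)}\le b-a$ for all integers $a<b$. For representable $\nu$ there are a unique $r\ge0$ and unique integers $1=b_0\le a_1<b_1<a_2<\cdots<a_r<b_r\le a_{r+1}=\lambda_1+1$ such that (1) $\#\nu|_{\subseteq[a_k,b_k)}=b_k-a_k$ for $1\le k\le r$, and (2) $\bigcup_{k=0}^r[b_k,a_{k+1})$ is inclusion-minimal among all such sequences satisfying (1). The irreducible components of $\nu$ are the $\nu|_{\cap[b_k,a_{k+1})}$, $0\le k\le r$; the $k$-th one corresponds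 to the columns in $[b_k,a_{k+1})$. -}

module Defs where

open import Data.List.Base using (List; []; _∷_; length; filter; concatMap; applyUpTo)
open import Data.List.Relation.Unary.All using (All)
open import Data.List.Relation.Unary.Linked using (Linked)
open import Data.Nat.Base using (ℕ; suc; _+_; _∸_; _≤_; _<_; _≥_; z≤n; s≤s; ∣_-_∣)
open import Data.Nat.Properties using (≤-refl; ≤-trans; _≤?_; _<?_; anyUpTo?; allUpTo?)
open import Data.Product.Base using (Σ; ∃; ∃₂; _×_; _,_; proj₁; proj₂)
open import Function.Bundles using (Func; _⟶ₛ_; _⇔_)
open import Relation.Binary.Bundles using (Setoid)
open import Relation.Binary.Construct.Closure.ReflexiveTransitive using (Star)
open import Relation.Binary.PropositionalEquality
  using (_≡_; _≢_; refl; sym; trans)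
open import Relation.Nullary.Decidable using (Dec; yes; no; map′; _×-dec_; _→-dec_)
open import Relation.Nullary.Negation using (contradiction)
open import Relation.Unary using (Pred; _⊆_)
import Algebra.Definitions as AlgDefs

record Partition : Set where
  field
    parts      : List ℕ
    decreasing : Linked _≥_ parts
    positive   : All (0 <_) parts

open Partition public

-- Parts are numbered from 1.  There is no part number 0; its value is set to 0,
-- so that row 0 contains no cells.
partOf : List ℕ → ℕ → ℕ
partOf []       _             = 0
partOf (x ∷ xs) 0             = 0
partOf (x ∷ xs) 1             = x
partOf (x ∷ xs) (suc (suc i)) = partOf xs (suc i)

part : Partition → ℕ → ℕ
part p = partOf (parts p)

record SkewPartition : Set where
  field
    outer     : Partition
    inner     : Partition
    contained : ∀ i → part inner i ≤ part outer i

open SkewPartition public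

-- (i , j) is in row i and column j; i ≥ 1 and j ≥ 1 hold automatically.
Cell : SkewPartition → ℕ → ℕ → Set
Cell s i j = part (inner s) i < j × j ≤ part (outer s) i

cell? : ∀ s i j → Dec (Cell s i j)
cell? s i j = (part (inner s) i <? j) ×-dec (j ≤? part (outer s) i)

height width : SkewPartition → ℕ
height s = length (parts (outer s))
width  s = part (outer s) 1

row≤height : ∀ s {i j} → Cell s i j → i ≤ height s
row≤height s (μ<j , j≤λ) = go (parts (outer s)) _ (≤-trans (s≤s z≤n) (≤-trans μ<j j≤λ))
  where
  go : ∀ xs i → 0 < partOf xs i → i ≤ length xs
  go (x ∷ xs) 1             _   = s≤s z≤n
  go (x ∷ xs) (suc (suc i)) pos = s≤s (go xs (suc i) pos)

Adjacent : ∀ s → ∃₂ (Cell s) → ∃₂ (Cell s) → Set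
Adjacent s (i , j , _) (i′ , j′ , _) = ∣ i - i′ ∣ + ∣ j - j′ ∣ ≡ 1

Connected : SkewPartition → Set
Connected s = ∀ c d → Star (Adjacent s) c d

NoEmptyColumns : SkewPartition → Set
NoEmptyColumns s = ∀ k → 1 ≤ k → k ≤ width s → ∃ λ i → Cell s i k

-- The integers j with a ≤ j < b, in increasing order.
interval : ℕ → ℕ → List ℕ
interval a b = applyUpTo (a +_) (b ∸ a)

data Entry : Set where
  one two : Entry

value : Entry → ℕ
value one = 1
value two = 2

infix 4 _⊑_ _≟ᵉ_

_⊑_ : Entry → Entry → Set
x ⊑ y = value x ≤ value y

_≟ᵉ_ : (x y : Entry) → Dec (x ≡ y)
one ≟ᵉ one = yes refl
one ≟ᵉ two = no λ ()
two ≟ᵉ one = no λ ()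
two ≟ᵉ two = yes refl

record Table (s : SkewPartition) : Set where
  field
    entry : ∀ i j → .(Cell s i j) → Entry
    down  : ∀ i i′ j (c : Cell s i j) (c′ : Cell s i′ j) →
            i ≤ i′ → entry i j c ⊑ entry i′ j c′

open Table public

private
  variable
    s : SkewPartition

-- Equality of tables as maps on the set of cells.
infix 4 _≈ᵗ_

_≈ᵗ_ : Table s → Table s → Set
_≈ᵗ_ {s} T U = ∀ i j (c : Cell s i j) → entry T i j c ≡ entry U i j c

IsRpp : Table s → Set
IsRpp {s} T = ∀ i j j′ (c : Cell s i j) (c′ : Cell s i j′) →
              j ≤ j′ → entry T i j c ⊑ entry T i j′ c′

HasEntry : Table s → ℕ → ℕ → Entry → Set
HasEntry {s} T i j x = Σ (Cell s i j) λ c → entry T i j c ≡ x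

hasEntry? : ∀ (T : Table s) i j x → Dec (HasEntry T i j x)
hasEntry? {s} T i j x with cell? s i j
... | no  ¬c = no λ (c , _) → ¬c c
... | yes c  = map′ (c ,_) proj₂ (entry T i j c ≟ᵉ x)

-- Column k is x-pure.
Pure : Entry → Table s → ℕ → Set
Pure {s} x T k = (∃ λ i → Cell s i k) × (∀ i (c : Cell s i k) → entry T i k c ≡ x)

Mixed : Table s → ℕ → Set
Mixed T k = (∃ λ i → HasEntry T i k one) × (∃ λ i → HasEntry T i k two)

-- Column k is mixed and sep_k T = r.
Sep : Table s → ℕ → ℕ → Set
Sep T k r = Mixed T k × HasEntry T r k two × (∀ i → HasEntry T i k two → r ≤ i)

Benign : Table s → Set
Benign T = ∀ k l r r′ → k < l → Sep T k r → Sep T l r′ → r′ ≤ r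

pure? : ∀ x (T : Table s) k → Dec (Pure x T k)
pure? {s} x T k = nonempty? ×-dec all?
  where
  nonempty? : Dec (∃ λ i → Cell s i k)
  nonempty? = map′ (λ (i , _ , c) → i , c) (λ (i , c) → i , s≤s (row≤height s c) , c)
                   (anyUpTo? (λ i → cell? s i k) (suc (height s)))

  at? : ∀ i → Dec ((c : Cell s i k) → entry T i k c ≡ x)
  at? i with cell? s i k
  ... | no  ¬c = yes λ c → contradiction c ¬c
  ... | yes c  = map′ (λ eq _ → eq) (λ f → f c) (entry T i k c ≟ᵉ x)

  all? : Dec (∀ i (c : Cell s i k) → entry T i k c ≡ x)
  all? = map′ (λ f i c → f (s≤s (row≤height s c)) c) (λ f {i} _ → f i)
              (allUpTo? at? (suc (height s)))

flip : Table s → Table s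
flip {s} T = record { entry = newEntry ; down = newDown }
  where
  newEntry : ∀ i j → .(Cell s i j) → Entry
  newEntry i j c with pure? one T j | pure? two T j
  ... | yes _ | _     = two
  ... | no _  | yes _ = one
  ... | no _  | no _  = entry T i j c

  newDown : ∀ i i′ j (c : Cell s i j) (c′ : Cell s i′ j) →
            i ≤ i′ → newEntry i j c ⊑ newEntry i′ j c′
  newDown i i′ j c c′ i≤i′ with pure? one T j | pure? two T j
  ... | yes _ | _     = ≤-refl
  ... | no _  | yes _ = ≤-refl
  ... | no _  | no _  = down T i i′ j c c′ i≤i′

Descent : Table s → ℕ → Set
Descent T k = ∃ λ r → HasEntry T r k two × HasEntry T r (suc k) one

-- How columns k and k + 1 of P change when the descent k is resolved to give Q.
data ResolvedColumns {s} (k : ℕ) (P Q : Table s) : Set where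
  mixed-pure1 : ∀ {r} → Sep P k r → Pure one P (suc k) →
       Pure one Q k → Sep Q (suc k) r → ResolvedColumns k P Q
  pure2-mixed : ∀ {r} → Pure two P k → Sep P (suc k) r →
       Sep Q k r → Pure two Q (suc k) → ResolvedColumns k P Q
  pure2-pure1 : Pure two P k → Pure one P (suc k) →
       Pure one Q k → Pure two Q (suc k) → ResolvedColumns k P Q

-- The relation res_k P = Q between benign tables.
record Resolves {s} (k : ℕ) (P Q : Table s) : Set where
  field
    benignP   : Benign P
    descent   : Descent P k
    benignQ   : Benign Q
    elsewhere : ∀ i j (c : Cell s i j) → j ≢ k → j ≢ suc k → entry Q i j c ≡ entry P i j c
    columns   : ResolvedColumns k P Q

infix 4 _↝_

_↝_ : Table s → Table s → Set
P ↝ Q = ∃ λ k → Resolves k P Q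

-- Q is a 12-rpp obtainable from P by finitely many descent resolutions, that
-- is, Q = norm P.
Norm : Table s → Table s → Set
Norm P Q = IsRpp Q × (∃ λ P′ → Star _↝_ P P′ × P′ ≈ᵗ Q)

sepCell? : ∀ (T : Table s) i j → Dec (HasEntry T i j one × HasEntry T (suc i) j two)
sepCell? T i j = hasEntry? T i j one ×-dec hasEntry? T (suc i) j two

-- Columns are scanned from left to right; each contributes at most one row.
seplist : Table s → List ℕ
seplist {s} T = concatMap (λ j → filter (λ i → sepCell? T i j) (interval 1 (suc (height s))))
                          (interval 1 (suc (width s)))

record RPP¹² (s : SkewPartition) (ν : Partition) : Set where
  field
    table     : Table s
    isRpp     : IsRpp table
    seplist≡ν : seplist table ≡ parts ν

open RPP¹² public

RPP-setoid : SkewPartition → Partition → Setoid _ _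
RPP-setoid s ν = record
  { Carrier       = RPP¹² s ν
  ; _≈_           = λ T U → table T ≈ᵗ table U
  ; isEquivalence = record
    { refl  = λ _ _ _ → refl
    ; sym   = λ e i j c → sym (e i j c)
    ; trans = λ e f i j c → trans (e i j c) (f i j c)
    }
  }

-- Maps from RPP¹²(s ; ν) to itself.
RPP-map : SkewPartition → Partition → Set
RPP-map s ν = RPP-setoid s ν ⟶ₛ RPP-setoid s ν

-- B is the map T ↦ norm (flip T): norm (flip T) is required to exist, to be
-- unique, and to be B T.
IsBenderKnuth : ∀ {s ν} → RPP-map s ν → Set
IsBenderKnuth {s} {ν} B =
  ∀ (T : RPP¹² s ν) (Q : Table s) → Norm (flip (table T)) Q ⇔ Q ≈ᵗ table (Func.to B T)

Supp : SkewPartition → ℕ → Pred ℕ _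
Supp s i j = Cell s i j × Cell s (suc i) j

SuppWithin : SkewPartition → ℕ → ℕ → Pred ℕ _
SuppWithin s a b i = ∀ j → Supp s i j → a ≤ j × j < b

suppWithin? : ∀ s a b i → Dec (SuppWithin s a b i)
suppWithin? s a b i =
  map′ (λ f j p → f (s≤s (proj₂ (proj₁ p))) p) (λ f {j} _ → f j)
       (allUpTo? (λ j → (cell? s i j ×-dec cell? s (suc i) j)
                          →-dec ((a ≤? j) ×-dec (j <? b)))
                 (suc (part (outer s) i)))

-- The number of entries of ν, with multiplicity, whose support lies in [a , b).
#within : SkewPartition → Partition → ℕ → ℕ → ℕ
#within s ν a b = length (filter (suppWithin? s a b) (parts ν))

Admissible : SkewPartition → Partition → Set
Admissible s ν = All (λ i → ∃ λ j → Supp s i j) (parts ν)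

-- It is enough to let a and b be natural numbers: supports are nonempty sets of
-- positive integers, so replacing a negative endpoint by 0 changes no count,
-- and if b ≤ 0 the count is 0.
Representable : SkewPartition → Partition → Set
Representable s ν = Admissible s ν × (∀ a b → a < b → #within s ν a b ≤ b ∸ a)

-- Sequences 1 = b₀ ≤ a₁ < b₁ < a₂ < ⋯ < a_r < b_r ≤ a_{r+1} = λ₁ + 1.  Only
-- the values b₀ , … , b_r and a₁ , … , a_{r+1} matter.
record Cuts (s : SkewPartition) : Set where
  field
    r      : ℕ
    a b    : ℕ → ℕ
    start  : b 0 ≡ 1
    end    : a (suc r) ≡ suc (width s)
    b₀≤a₁  : b 0 ≤ a 1
    a<b    : ∀ k → 1 ≤ k → k ≤ r → a k < b k
    b<a    : ∀ k → 1 ≤ k → k < r → b k < a (suc k)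
    bᵣ≤a   : b r ≤ a (suc r)

Tight : ∀ {s} → Partition → Cuts s → Set
Tight {s} ν d = ∀ k → 1 ≤ k → k ≤ r → #within s ν (a k) (b k) ≡ b k ∸ a k
  where open Cuts d

-- The union of the intervals [b_k , a_{k+1}) for 0 ≤ k ≤ r.
Covered : Cuts s → Pred ℕ _
Covered d j = ∃ λ k → k ≤ r × b k ≤ j × j < a (suc k)
  where open Cuts d

-- d is the sequence that defines the irreducible components of ν; the columns
-- of the k-th component, for 0 ≤ k ≤ r, are those in [b_k , a_{k+1}).
CutsIntoComponents : ∀ {s} → Partition → Cuts s → Set
CutsIntoComponents {s} ν d =
  Tight ν d × (∀ (d′ : Cuts s) → Tight ν d′ → Covered d′ ⊆ Covered d → Covered d ⊆ Covered d′)

#pure : Entry → Table s → ℕ → ℕ → ℕ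
#pure x T a b = length (filter (pure? x T) (interval a b))

Involution : ∀ {s ν} → RPP-map s ν → Set
Involution {s} {ν} f = Involutive (Func.to f)
  where open AlgDefs (Setoid._≈_ (RPP-setoid s ν)) using (Involutive)

InterchangesPureCounts : ∀ {s ν} → Cuts s → RPP-map s ν → Set
InterchangesPureCounts {s} {ν} d f = ∀ (T : RPP¹² s ν) k → k ≤ r →
    #pure one (table (Func.to f T)) (b k) (a (suc k)) ≡ #pure two (table T) (b k) (a (suc k))
  × #pure two (table (Func.to f T)) (b k) (a (suc k)) ≡ #pure one (table T) (b k) (a (suc k))
  where open Cuts d

{-# OPTIONS --safe #-}

-- Column j consists of the rows top j ≤ i < bot j, and a 12-table is given by separators
-- top j ≤ t j ≤ bot j, where entry (i , j) is 2 iff t j ≤ i: column j is 1-pure if t j = bot j,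
-- 2-pure if t j = top j, and mixed otherwise.  A descent at k is an ascent t k < t (k + 1), so
-- 12-rpps are the weakly decreasing t.  Resolving a descent exchanges the kinds of two
-- neighbouring columns; a potential shows that this terminates.
--
-- By pigeonhole, all columns of a tight interval [a , b), one with exactly b − a entries of ν
-- supported in it, are mixed.  Hence resolutions preserve the numbers of 1-pure and 2-pure columns
-- in each component, and the columns of the components are those in no tight interval.
--
-- A 12-rpp is determined by ν and its numbers of 1-pure columns in the components (comparison at
-- the first column where two of them differ).  This gives the uniqueness of norm without
-- confluence, and that the map is an involution and the only one with the interchange property.
module Submission where

open import Defs
open import Algebra.Core using (Op₂)
open import Algebra.Structures using (IsMonoid)
open import Data.Bool.Base using (true; false; if_then_else_)
open import Data.List.Base using (List; []; _∷_; [_]; _++_; length; filter; concatMap; applyUpTo)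
open import Data.List.Properties
open import Data.List.Relation.Unary.All as All using (All)
open import Data.List.Relation.Unary.Linked using (Linked; []; [-]; _∷_)
open import Data.Nat.Base
open import Data.Nat.Induction using (<-wellFounded)
open import Data.Nat.Properties
open import Data.Nat.Solver using (module +-*-Solver)
open import Data.Product.Base using (Σ; ∃; ∃₂; _×_; _,_; proj₁; proj₂)
open import Data.Sum.Base using (_⊎_; inj₁; inj₂; [_,_]′)
open import Function.Base using (_∘_)
open import Function.Bundles using (Func; _⇔_; mk⇔; module Equivalence)
open import Induction.WellFounded using (Acc; acc)
open import Relation.Binary.Construct.Closure.ReflexiveTransitive using (Star; _◅_) renaming (ε to nil)
open import Relation.Binary.Definitions using (tri<; tri≈; tri>)
open import Relation.Binary.PropositionalEquality hiding ([_])
open import Relation.Nullary.Decidable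
  using (Dec; yes; no; does; dec-true; dec-false; does-⇔; decidable-stable; _×-dec_; ¬?)
open import Relation.Nullary.Negation using (¬_; contradiction)
open import Relation.Unary using (Decidable)

-- Resolutions move pure columns about inside a component, so a normal form has to be recognised by
-- invariants. They suffice because in a 12-rpp, on a stretch of columns that lie in no tight
-- interval, no 2-pure column stands left of a 1-pure one: a closest such pair would have a tight
-- interval between its columns, or would violate connectedness if they are neighbours. This fixes
-- the order of the pure columns, and their numbers do the rest.
--
-- The cuts in the statement are only assumed inclusion-minimal. Overlapping or adjacent tight
-- intervals merge into a tight one, since the number of entries supported in an interval is
-- supermodular. Hence the maximal runs of columns in tight intervals are tight themselves; the
-- remaining columns are covered by every tight sequence of cuts, so they are exactly what a minimal
-- one covers.
--
-- Counts are kept as prefix sums and the seplist as a concatenation over columns. A resolution can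
-- then show only in the prefix that ends between its two columns.

-- The value `x + n` signals an unsuccessful search; the bounds are chosen so that this default is
-- the right end of the range in question.
first : ∀ {P : ℕ → Set} → Decidable P → ℕ → ℕ → ℕ
first P? x zero = x
first P? x (suc n) with P? x
... | yes _ = x
... | no  _ = first P? (suc x) n

module _ {P : ℕ → Set} (P? : Decidable P) where

  first-≥ : ∀ x n → x ≤ first P? x n
  first-≥ x zero = ≤-refl
  first-≥ x (suc n) with P? x
  ... | yes _ = ≤-refl
  ... | no  _ = <⇒≤ (first-≥ (suc x) n)

  first-≤ : ∀ x n → first P? x n ≤ x + n
  first-≤ x zero = m≤m+n x 0
  first-≤ x (suc n) with P? x
  ... | yes _ = m≤m+n x (suc n)
  ... | no  _ = ≤-trans (first-≤ (suc x) n) (≤-reflexive (sym (+-suc x n)))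

  first-holds : ∀ x n → first P? x n < x + n → P (first P? x n)
  first-holds x zero    lt = contradiction lt (≤⇒≯ (≤-reflexive (+-identityʳ x)))
  first-holds x (suc n) lt with P? x
  ... | yes p = p
  ... | no  _ = first-holds (suc x) n (<-≤-trans lt (≤-reflexive (+-suc x n)))

  first-minimal : ∀ x n i → x ≤ i → i < first P? x n → ¬ P i
  first-minimal x zero    i x≤i lt = contradiction lt (≤⇒≯ x≤i)
  first-minimal x (suc n) i x≤i lt with P? x
  ... | yes _ = contradiction lt (≤⇒≯ x≤i)
  ... | no ¬p with m≤n⇒m<n∨m≡n x≤i
  ...   | inj₁ x<i  = first-minimal (suc x) n i x<i lt
  ...   | inj₂ refl = ¬p

-- Prefix products in a monoid, for sums and for concatenations

module Prefix {A : Set} {_∙_ : Op₂ A} {ε : A} (isMonoid : IsMonoid _≡_ _∙_ ε) where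

  open IsMonoid isMonoid using (assoc; identityˡ; identityʳ)

  prefix : (ℕ → A) → ℕ → A
  prefix f zero    = ε
  prefix f (suc n) = prefix f n ∙ f n

  prefix-cong : ∀ {f g} n → (∀ j → j < n → f j ≡ g j) → prefix f n ≡ prefix g n
  prefix-cong zero    f≗g = refl
  prefix-cong (suc n) f≗g =
    cong₂ _∙_ (prefix-cong n λ j j<n → f≗g j (m<n⇒m<1+n j<n)) (f≗g n ≤-refl)

  prefix-ε : ∀ {f} n → (∀ j → j < n → f j ≡ ε) → prefix f n ≡ ε
  prefix-ε zero    f≗ε = refl
  prefix-ε (suc n) f≗ε =
    trans (cong₂ _∙_ (prefix-ε n λ j j<n → f≗ε j (m<n⇒m<1+n j<n)) (f≗ε n ≤-refl)) (identityˡ ε)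

  prefix-+ : ∀ f m n → prefix f (m + n) ≡ prefix f m ∙ prefix (f ∘ (m +_)) n
  prefix-+ f m zero    = trans (cong (prefix f) (+-identityʳ m)) (sym (identityʳ _))
  prefix-+ f m (suc n) = trans (cong (prefix f) (+-suc m n))
    (trans (cong (_∙ f (m + n)) (prefix-+ f m n)) (assoc _ _ _))

  prefix-single : ∀ {f} i n → i < n → (∀ j → j ≢ i → f j ≡ ε) → prefix f n ≡ f i
  prefix-single {f} i (suc n) i<1+n f≗ε with n ≟ i
  ... | yes refl = trans (cong (_∙ f n) (prefix-ε n λ j j<n → f≗ε j (<⇒≢ j<n))) (identityˡ _)
  ... | no  n≢i  = trans (cong₂ _∙_ (prefix-single i n (≤∧≢⇒< (s≤s⁻¹ i<1+n) (n≢i ∘ sym)) f≗ε) (f≗ε n n≢i))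
                         (identityʳ _)

  -- Only the prefix of length `suc k` separates the positions `k` and `suc k`; every other one
  -- contains both or neither. With `f` and `g` read off before and after a resolution, this yields
  -- the invariance of the seplist and of the pure counts, and the behaviour of the potential.
  prefix-swap : ∀ {f g} k → (∀ j → j ≢ k → j ≢ suc k → f j ≡ g j) →
                f k ∙ f (suc k) ≡ g k ∙ g (suc k) →
                ∀ n → n ≢ suc k → prefix f n ≡ prefix g n
  prefix-swap         k f≗g eq zero    n≢ = refl
  prefix-swap {f} {g} k f≗g eq (suc n) n≢ with n ≟ suc k
  ... | yes refl = begin
    (prefix f k ∙ f k) ∙ f (suc k) ≡⟨ assoc _ _ _ ⟩
    prefix f k ∙ (f k ∙ f (suc k)) ≡⟨ cong₂ _∙_ (prefix-swap k f≗g eq k (<⇒≢ ≤-refl)) eq ⟩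
    prefix g k ∙ (g k ∙ g (suc k)) ≡⟨ assoc _ _ _ ⟨
    (prefix g k ∙ g k) ∙ g (suc k) ∎
    where open ≡-Reasoning
  ... | no n≢1+k = cong₂ _∙_ (prefix-swap k f≗g eq n n≢1+k) (f≗g n (n≢ ∘ cong suc) n≢1+k)

open Prefix +-0-isMonoid
  renaming ( prefix to sum<; prefix-cong to sum<-cong; prefix-ε to sum<-zero; prefix-+ to sum<-+
           ; prefix-swap to sum<-swap )
module Concat = Prefix (++-isMonoid {A = ℕ})
open Concat using () renaming (prefix to concat<)

module _ {f g : ℕ → ℕ} (f≤g : ∀ j → f j ≤ g j) where

  sum<-mono : ∀ n → sum< f n ≤ sum< g n
  sum<-mono zero    = z≤n
  sum<-mono (suc n) = +-mono-≤ (sum<-mono n) (f≤g n)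

  sum<-mono-< : ∀ {k} n → k < n → f k < g k → sum< f n < sum< g n
  sum<-mono-< {k} (suc n) k<1+n fk<gk with n ≟ k
  ... | yes refl = +-mono-≤-< (sum<-mono n) fk<gk
  ... | no  n≢k  = +-mono-<-≤ (sum<-mono-< n (≤∧≢⇒< (s≤s⁻¹ k<1+n) (n≢k ∘ sym)) fk<gk) (f≤g n)

sum<-monoʳ : ∀ f {m n} → m ≤ n → sum< f m ≤ sum< f n
sum<-monoʳ f {m} {n} m≤n = begin
  sum< f m                                        ≤⟨ m≤m+n _ _ ⟩
  sum< f m + sum< (λ j → f (m + j)) (n ∸ m)       ≡⟨ sum<-+ f m (n ∸ m) ⟨
  sum< f (m + (n ∸ m))                            ≡⟨ cong (sum< f) (m+[n∸m]≡n m≤n) ⟩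
  sum< f n                                        ∎
  where open ≤-Reasoning

sum<-flat : ∀ f {m} n → m ≤ n → (∀ j → m ≤ j → j < n → f j ≡ 0) → sum< f n ≡ sum< f m
sum<-flat f {m} n m≤n f≗0 with m≤n⇒m<n∨m≡n m≤n
... | inj₂ refl = refl
sum<-flat f (suc n) m≤n f≗0 | inj₁ m<n = trans
  (cong₂ _+_ (sum<-flat f n (s≤s⁻¹ m<n) λ j m≤j j<n → f≗0 j m≤j (m<n⇒m<1+n j<n)) (f≗0 n (s≤s⁻¹ m<n) ≤-refl))
  (+-identityʳ _)

sum<-≤1 : ∀ f {m} n → m ≤ n → (∀ j → f j ≤ 1) → sum< f n ≤ sum< f m + (n ∸ m)
sum<-≤1 f {m} n m≤n f≤1 with m≤n⇒m<n∨m≡n m≤n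
... | inj₂ refl = m≤m+n _ _
sum<-≤1 f {m} (suc n) m≤n f≤1 | inj₁ m<n = begin
  sum< f n + f n            ≤⟨ +-mono-≤ (sum<-≤1 f n (s≤s⁻¹ m<n) f≤1) (f≤1 n) ⟩
  sum< f m + (n ∸ m) + 1    ≡⟨ +-assoc (sum< f m) (n ∸ m) 1 ⟩
  sum< f m + ((n ∸ m) + 1)  ≡⟨ cong (sum< f m +_) (+-comm (n ∸ m) 1) ⟩
  sum< f m + suc (n ∸ m)    ≡⟨ cong (sum< f m +_) (sym (+-∸-assoc 1 (s≤s⁻¹ m<n))) ⟩
  sum< f m + (suc n ∸ m)    ∎
  where open ≤-Reasoning

sum<-≥1 : ∀ f {m} n → m ≤ n → (∀ j → m ≤ j → j < n → 1 ≤ f j) → sum< f m + (n ∸ m) ≤ sum< f n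
sum<-≥1 f {m} n m≤n f≥1 with m≤n⇒m<n∨m≡n m≤n
... | inj₂ refl = ≤-reflexive (trans (cong (sum< f m +_) (n∸n≡0 m)) (+-identityʳ _))
sum<-≥1 f {m} (suc n) m≤n f≥1 | inj₁ m<n = begin
  sum< f m + (suc n ∸ m)    ≡⟨ cong (sum< f m +_) (+-∸-assoc 1 (s≤s⁻¹ m<n)) ⟩
  sum< f m + suc (n ∸ m)    ≡⟨ cong (sum< f m +_) (+-comm (n ∸ m) 1) ⟨
  sum< f m + ((n ∸ m) + 1)  ≡⟨ +-assoc (sum< f m) (n ∸ m) 1 ⟨
  sum< f m + (n ∸ m) + 1    ≤⟨ +-mono-≤
    (sum<-≥1 f n (s≤s⁻¹ m<n) λ j m≤j j<n → f≥1 j m≤j (m<n⇒m<1+n j<n)) (f≥1 n (s≤s⁻¹ m<n) ≤-refl) ⟩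
  sum< f n + f n            ∎
  where open ≤-Reasoning

-- Filtered lists as sums and concatenations

indicator : ∀ {A : Set} → Dec A → ℕ
indicator a? = if does a? then 1 else 0

indicator-true : ∀ {A : Set} (a? : Dec A) → A → indicator a? ≡ 1
indicator-true a? a = cong (if_then 1 else 0) (dec-true a? a)

indicator-false : ∀ {A : Set} (a? : Dec A) → ¬ A → indicator a? ≡ 0
indicator-false a? ¬a = cong (if_then 1 else 0) (dec-false a? ¬a)

indicator-⇔ : ∀ {A B : Set} → A ⇔ B → (a? : Dec A) (b? : Dec B) → indicator a? ≡ indicator b?
indicator-⇔ A⇔B a? b? = cong (if_then 1 else 0) (does-⇔ A⇔B a? b?)

concatMap-applyUpTo : ∀ (g : ℕ → List ℕ) f n → concatMap g (applyUpTo f n) ≡ concat< (g ∘ f) n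
concatMap-applyUpTo g f zero    = refl
concatMap-applyUpTo g f (suc n) = begin
  concatMap g (applyUpTo f (suc n))                     ≡⟨ cong (concatMap g) (applyUpTo-∷ʳ f n) ⟨
  concatMap g (applyUpTo f n ++ [ f n ])                ≡⟨ concatMap-++ g (applyUpTo f n) [ f n ] ⟩
  concatMap g (applyUpTo f n) ++ concatMap g [ f n ]    ≡⟨ cong₂ _++_ (concatMap-applyUpTo g f n) (++-identityʳ (g (f n))) ⟩
  concat< (g ∘ f) n ++ g (f n)                          ∎
  where open ≡-Reasoning

module _ {P : ℕ → Set} (P? : Decidable P) where

  filter-applyUpTo : ∀ f n → filter P? (applyUpTo f n) ≡ concat< (λ j → filter P? [ f j ]) n
  filter-applyUpTo f zero    = refl
  filter-applyUpTo f (suc n) = begin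
    filter P? (applyUpTo f (suc n))                  ≡⟨ cong (filter P?) (applyUpTo-∷ʳ f n) ⟨
    filter P? (applyUpTo f n ++ [ f n ])             ≡⟨ filter-++ P? (applyUpTo f n) [ f n ] ⟩
    filter P? (applyUpTo f n) ++ filter P? [ f n ]   ≡⟨ cong (_++ filter P? [ f n ]) (filter-applyUpTo f n) ⟩
    concat< (λ j → filter P? [ f j ]) (suc n)        ∎
    where open ≡-Reasoning

  length-filter-concat< : ∀ f n → length (filter P? (concat< f n)) ≡ sum< (λ j → length (filter P? (f j))) n
  length-filter-concat< f zero    = refl
  length-filter-concat< f (suc n) = begin
    length (filter P? (concat< f n ++ f n))                          ≡⟨ cong length (filter-++ P? (concat< f n) (f n)) ⟩
    length (filter P? (concat< f n) ++ filter P? (f n))              ≡⟨ length-++ (filter P? (concat< f n)) ⟩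
    length (filter P? (concat< f n)) + length (filter P? (f n))
      ≡⟨ cong (_+ length (filter P? (f n))) (length-filter-concat< f n) ⟩
    sum< (λ j → length (filter P? (f j))) (suc n)                    ∎
    where open ≡-Reasoning

  length-filter-[] : ∀ x → length (filter P? [ x ]) ≡ indicator (P? x)
  length-filter-[] x with does (P? x)
  ... | true  = refl
  ... | false = refl

  length-filter-interval : ∀ {a b} → a ≤ b →
    sum< (indicator ∘ P?) a + length (filter P? (interval a b)) ≡ sum< (indicator ∘ P?) b
  length-filter-interval {a} {b} a≤b = begin
    sum< (indicator ∘ P?) a + length (filter P? (interval a b))
      ≡⟨ cong (sum< (indicator ∘ P?) a +_) (go (a +_) (b ∸ a)) ⟩
    sum< (indicator ∘ P?) a + sum< (indicator ∘ P? ∘ (a +_)) (b ∸ a)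
      ≡⟨ sum<-+ (indicator ∘ P?) a (b ∸ a) ⟨
    sum< (indicator ∘ P?) (a + (b ∸ a))
      ≡⟨ cong (sum< (indicator ∘ P?)) (m+[n∸m]≡n a≤b) ⟩
    sum< (indicator ∘ P?) b ∎
    where
    open ≡-Reasoning
    go : ∀ f n → length (filter P? (applyUpTo f n)) ≡ sum< (indicator ∘ P? ∘ f) n
    go f n = begin
      length (filter P? (applyUpTo f n))               ≡⟨ cong (length ∘ filter P?) (concatMap-pure (applyUpTo f n)) ⟨
      length (filter P? (concatMap [_] (applyUpTo f n))) ≡⟨ cong (length ∘ filter P?) (concatMap-applyUpTo [_] f n) ⟩
      length (filter P? (concat< ([_] ∘ f) n))          ≡⟨ length-filter-concat< ([_] ∘ f) n ⟩
      sum< (λ j → length (filter P? [ f j ])) n         ≡⟨ sum<-cong n (λ j _ → length-filter-[] (f j)) ⟩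
      sum< (indicator ∘ P? ∘ f) n                       ∎

-- Parts of a partition and columns of a skew diagram

partOf-beyond : ∀ xs i → length xs < i → partOf xs i ≡ 0
partOf-beyond []       i             _        = refl
partOf-beyond (x ∷ xs) (suc (suc i)) (s≤s lt) = partOf-beyond xs (suc i) lt

partOf-suc : ∀ {xs} → Linked _≥_ xs → ∀ i → partOf xs (suc (suc i)) ≤ partOf xs (suc i)
partOf-suc []              i       = z≤n
partOf-suc [-]             i       = z≤n
partOf-suc (x≥y ∷ ys)      zero    = x≥y
partOf-suc (_ ∷ ys)        (suc i) = partOf-suc ys i

partOf-zero : ∀ xs → partOf xs 0 ≡ 0
partOf-zero []      = refl
partOf-zero (_ ∷ _) = refl

part-antitone : ∀ p {i i′} → 1 ≤ i → i ≤ i′ → part p i′ ≤ part p i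
part-antitone p {i@(suc i₀)} {i′} _ i≤i′ =
  subst (λ x → part p x ≤ part p i) (m+[n∸m]≡n i≤i′) (go (i′ ∸ i))
  where
  go : ∀ n → part p (i + n) ≤ part p i
  go zero    = ≤-reflexive (cong (part p) (+-identityʳ i))
  go (suc n) = ≤-trans (≤-reflexive (cong (part p) (+-suc i n)))
                       (≤-trans (partOf-suc (decreasing p) (i₀ + n)) (go n))

module Columns (s : SkewPartition) where

  private
    λ′ μ′ : ℕ → ℕ
    λ′ = part (outer s)
    μ′ = part (inner s)

  -- The default `suc (height s)` is sound because both partitions have part 0 there. Empty columns,
  -- among them column 0 and all columns beyond the width, get `top j ≡ bot j`, which leaves a
  -- single valid separator.
  top bot : ℕ → ℕ
  top j = first (λ i → μ′ i <? j) 1 (height s)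
  bot j = first (λ i → λ′ i <? j) 1 (height s)

  outer-beyond : λ′ (suc (height s)) ≡ 0
  outer-beyond = partOf-beyond (parts (outer s)) _ ≤-refl

  first-part : ∀ (ρ : ℕ → ℕ) → ρ (suc (height s)) ≡ 0 → ∀ {j} → 1 ≤ j →
               ρ (first (λ i → ρ i <? j) 1 (height s)) < j
  first-part ρ ρ≡0 {j} 1≤j with first-≤ (λ i → ρ i <? j) 1 (height s)
  ... | le with m≤n⇒m<n∨m≡n le
  ... | inj₁ lt = first-holds (λ i → ρ i <? j) 1 (height s) lt
  ... | inj₂ eq = subst (λ i → ρ i < j) (sym eq) (subst (_< j) (sym ρ≡0) 1≤j)

  inner-top : ∀ {j} → 1 ≤ j → μ′ (top j) < j
  inner-top = first-part μ′ (n≤0⇒n≡0 (≤-trans (contained s _) (≤-reflexive outer-beyond)))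

  outer-bot : ∀ {j} → 1 ≤ j → λ′ (bot j) < j
  outer-bot = first-part λ′ outer-beyond

  first-part-≤ : ∀ (ρ : ℕ → ℕ) {j i} → 1 ≤ i → ρ i < j → first (λ i → ρ i <? j) 1 (height s) ≤ i
  first-part-≤ ρ {j} 1≤i ρi<j =
    ≮⇒≥ λ i<first → first-minimal (λ i → ρ i <? j) 1 (height s) _ 1≤i i<first ρi<j

  first-part-anti : ∀ (ρ : ℕ → ℕ) {j j′} → j ≤ j′ →
    first (λ i → ρ i <? j′) 1 (height s) ≤ first (λ i → ρ i <? j) 1 (height s)
  first-part-anti ρ {j} {j′} j≤j′ with first-≤ (λ i → ρ i <? j) 1 (height s)
  ... | le with m≤n⇒m<n∨m≡n le
  ... | inj₁ lt = first-part-≤ ρ (first-≥ (λ i → ρ i <? j) 1 (height s))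
                    (<-≤-trans (first-holds (λ i → ρ i <? j) 1 (height s) lt) j≤j′)
  ... | inj₂ eq = ≤-trans (first-≤ (λ i → ρ i <? j′) 1 (height s)) (≤-reflexive (sym eq))

  top-antitone : ∀ {j j′} → j ≤ j′ → top j′ ≤ top j
  top-antitone = first-part-anti μ′

  bot-antitone : ∀ {j j′} → j ≤ j′ → bot j′ ≤ bot j
  bot-antitone = first-part-anti λ′

  top≥1 : ∀ j → 1 ≤ top j
  top≥1 j = first-≥ (λ i → μ′ i <? j) 1 (height s)

  top≤bot : ∀ j → top j ≤ bot j
  top≤bot zero = ≤-reflexive (first-0 (height s) 1)
    where
    first-0 : ∀ n x → first (λ i → μ′ i <? 0) x n ≡ first (λ i → λ′ i <? 0) x n
    first-0 zero    x = refl
    first-0 (suc n) x = first-0 n (suc x)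
  top≤bot j@(suc _) = first-part-≤ μ′ (first-≥ (λ i → λ′ i <? j) 1 (height s))
    (≤-<-trans (contained s (bot j)) (outer-bot (s≤s z≤n)))

  cell-bounds : ∀ {i j} → Cell s i j → top j ≤ i × i < bot j
  cell-bounds {zero} {j} (μ<j , j≤λ) = contradiction (<-≤-trans (≤-<-trans z≤n μ<j) j≤λ)
    (≤⇒≯ (≤-reflexive (partOf-zero (parts (outer s)))))
  cell-bounds {suc i} {j} (μ<j , j≤λ) = first-part-≤ μ′ (s≤s z≤n) μ<j ,
    ≰⇒> λ bot≤i → <-irrefl refl (<-≤-trans (outer-bot (≤-trans (s≤s z≤n) μ<j))
      (≤-trans j≤λ (part-antitone (outer s) (first-≥ (λ i → λ′ i <? j) 1 (height s)) bot≤i)))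

  bounds-cell : ∀ {i j} → top j ≤ i → i < bot j → Cell s i j
  bounds-cell {i} {zero}  top≤i i<bot =
    contradiction (≤-<-trans top≤i i<bot) (≤⇒≯ (bot≤top (height s) 1))
    where
    bot≤top : ∀ n x → first (λ i → λ′ i <? 0) x n ≤ first (λ i → μ′ i <? 0) x n
    bot≤top zero    x = ≤-refl
    bot≤top (suc n) x = bot≤top n (suc x)
  bounds-cell {i} {j@(suc _)} top≤i i<bot =
    ≤-<-trans (part-antitone (inner s) (top≥1 j) top≤i) (inner-top (s≤s z≤n)) ,
    ≮⇒≥ (first-minimal (λ i → λ′ i <? j) 1 (height s) i (≤-trans (top≥1 j) top≤i) i<bot)

  Column : ℕ → Set
  Column j = top j < bot j

  column-cell : ∀ {j} → Column j → Cell s (top j) j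
  column-cell = bounds-cell ≤-refl

  cell-column : ∀ {i j} → Cell s i j → Column j
  cell-column c = let top≤i , i<bot = cell-bounds c in ≤-<-trans top≤i i<bot

  column-range : ∀ {j} → Column j → 1 ≤ j × j ≤ width s
  column-range {j} col = let μ<j , j≤λ = column-cell col in
    ≤-trans (s≤s z≤n) μ<j , ≤-trans j≤λ (part-antitone (outer s) ≤-refl (top≥1 j))

  supp-bounds : ∀ {i j} → Supp s i j → top j < suc i × suc i < bot j
  supp-bounds (c , c′) = s≤s (proj₁ (cell-bounds c)) , proj₂ (cell-bounds c′)

  bounds-supp : ∀ {i j} → top j < suc i → suc i < bot j → Supp s i j
  bounds-supp top<i i<bot =
    bounds-cell (s≤s⁻¹ top<i) (<-trans ≤-refl i<bot) , bounds-cell (<⇒≤ top<i) i<bot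

  module _ (noEmpty : NoEmptyColumns s) where

    range-column : ∀ {j} → 1 ≤ j → j ≤ width s → Column j
    range-column 1≤j j≤w = cell-column (proj₂ (noEmpty _ 1≤j j≤w))

  -- A step of the path changes the column by at most 1, so some step leads from column `k` to
  -- column `suc k`; it uses up the whole distance 1 and stays in its row.
  crossing : ∀ {c d} k → Star (Adjacent s) c d → proj₁ (proj₂ c) ≤ k → k < proj₁ (proj₂ d) →
             ∃ λ i → Cell s i k × Cell s i (suc k)
  crossing k nil c≤k k<d = contradiction k<d (≤⇒≯ c≤k)
  crossing {i , j , c} k (_◅_ {j = i′ , j′ , c′} adj path) j≤k k<d with j′ ≤? k
  ... | yes j′≤k = crossing k path j′≤k k<d
  ... | no  j′≰k = i , subst (Cell s i) j≡k c , subst₂ (Cell s) (sym i≡i′) j′≡1+k c′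
    where
    k<j′ : k < j′
    k<j′ = ≰⇒> j′≰k
    j′≤1+j : j′ ≤ suc j
    j′≤1+j = begin
      j′                               ≤⟨ m≤n+∣n-m∣ j′ j ⟩
      j + ∣ j - j′ ∣                   ≤⟨ +-monoʳ-≤ j (≤-trans (m≤n+m _ ∣ i - i′ ∣) (≤-reflexive adj)) ⟩
      j + 1                            ≡⟨ +-comm j 1 ⟩
      suc j                            ∎
      where open ≤-Reasoning
    j≡k : j ≡ k
    j≡k = ≤-antisym j≤k (s≤s⁻¹ (≤-trans k<j′ j′≤1+j))
    j′≡1+k : j′ ≡ suc k
    j′≡1+k = ≤-antisym (≤-trans j′≤1+j (s≤s j≤k)) k<j′
    i≡i′ : i ≡ i′
    i≡i′ = ∣m-n∣≡0⇒m≡n (+-cancelʳ-≡ 1 ∣ i - i′ ∣ 0 (trans (cong (∣ i - i′ ∣ +_) (sym one-apart)) adj))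
      where
      one-apart : ∣ j - j′ ∣ ≡ 1
      one-apart = trans (cong₂ ∣_-_∣ j≡k j′≡1+k) (trans (cong (∣ k -_∣) (+-comm 1 k)) (∣m-m+n∣≡n k 1))

  -- Connectedness enters here: neighbouring columns share a row, so a 2-pure column directly left
  -- of a 1-pure one is a descent.
  neighbours-overlap : Connected s → ∀ {k} → Column k → Column (suc k) → top k < bot (suc k)
  neighbours-overlap connected {k} col col′ =
    let i , c , c′ = crossing k (connected (_ , _ , column-cell col) (_ , _ , column-cell col′)) ≤-refl ≤-refl
    in ≤-<-trans (proj₁ (cell-bounds c)) (proj₂ (cell-bounds c′))

-- Tables as sequences of separators

module Separators (s : SkewPartition) where

  open Columns s

  Valid : (ℕ → ℕ) → Set
  Valid t = ∀ j → top j ≤ t j × t j ≤ bot j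

  One Two Mix : (ℕ → ℕ) → ℕ → Set
  One t j = Column j × t j ≡ bot j
  Two t j = Column j × t j ≡ top j
  Mix t j = top j < t j × t j < bot j

  one? : ∀ t j → Dec (One t j)
  one? t j = (top j <? bot j) ×-dec (t j ≟ bot j)

  two? : ∀ t j → Dec (Two t j)
  two? t j = (top j <? bot j) ×-dec (t j ≟ top j)

  mix? : ∀ t j → Dec (Mix t j)
  mix? t j = (top j <? t j) ×-dec (t j <? bot j)

  mix-column : ∀ {t j} → Mix t j → Column j
  mix-column (top<t , t<bot) = <-trans top<t t<bot

  data Kind (t : ℕ → ℕ) (j : ℕ) : Set where
    isOne : One t j → Kind t j
    isTwo : Two t j → Kind t j
    isMix : Mix t j → Kind t j

  kind : ∀ {t} → Valid t → ∀ {j} → Column j → Kind t j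
  kind valid {j} col with m≤n⇒m<n∨m≡n (proj₁ (valid j)) | m≤n⇒m<n∨m≡n (proj₂ (valid j))
  ... | inj₂ top≡t | _          = isTwo (col , sym top≡t)
  ... | inj₁ top<t | inj₁ t<bot = isMix (top<t , t<bot)
  ... | inj₁ _     | inj₂ t≡bot = isOne (col , t≡bot)

  one≢two : ∀ {t j} → One t j → ¬ Two t j
  one≢two (col , t≡bot) (_ , t≡top) = <⇒≢ col (trans (sym t≡top) t≡bot)

  one≢mix : ∀ {t j} → One t j → ¬ Mix t j
  one≢mix (_ , t≡bot) (_ , t<bot) = <⇒≢ t<bot t≡bot

  two≢mix : ∀ {t j} → Two t j → ¬ Mix t j
  two≢mix (_ , t≡top) (top<t , _) = <⇒≢ top<t (sym t≡top)

  record Represents (t : ℕ → ℕ) (T : Table s) : Set where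
    field
      valid  : Valid t
      above  : ∀ {i j} (c : Cell s i j) → i < t j → entry T i j c ≡ one
      below  : ∀ {i j} (c : Cell s i j) → t j ≤ i → entry T i j c ≡ two

  open Represents

  fromSeparators : (ℕ → ℕ) → Table s
  fromSeparators t = record { entry = λ i j _ → shade i j ; down = λ i i′ j _ _ → shade-mono i i′ j }
    where
    shade : ℕ → ℕ → Entry
    shade i j with t j ≤? i
    ... | yes _ = two
    ... | no  _ = one
    shade-mono : ∀ i i′ j → i ≤ i′ → shade i j ⊑ shade i′ j
    shade-mono i i′ j i≤i′ with t j ≤? i | t j ≤? i′
    ... | yes _   | yes _    = ≤-refl
    ... | yes t≤i | no  t≰i′ = contradiction (≤-trans t≤i i≤i′) t≰i′
    ... | no  _   | yes _    = s≤s z≤n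
    ... | no  _   | no  _    = ≤-refl

  fromSeparators-represents : ∀ {t} → Valid t → Represents t (fromSeparators t)
  fromSeparators-represents {t} valid-t = record { valid = valid-t ; above = above′ ; below = below′ }
    where
    above′ : ∀ {i j} (c : Cell s i j) → i < t j → entry (fromSeparators t) i j c ≡ one
    above′ {i} {j} c i<t with t j ≤? i
    ... | yes t≤i = contradiction i<t (≤⇒≯ t≤i)
    ... | no  _   = refl
    below′ : ∀ {i j} (c : Cell s i j) → t j ≤ i → entry (fromSeparators t) i j c ≡ two
    below′ {i} {j} c t≤i with t j ≤? i
    ... | yes _   = refl
    ... | no  t≰i = contradiction t≤i t≰i

  separators : Table s → ℕ → ℕ
  separators T j = first (λ i → ¬? (hasEntry? T i j one)) (top j) (bot j ∸ top j)

  ¬one⇒two : ∀ {x} → x ≢ one → x ≡ two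
  ¬one⇒two {one} x≢one = contradiction refl x≢one
  ¬one⇒two {two} _     = refl

  two⊑ : ∀ {x y} → x ⊑ y → x ≡ two → y ≡ two
  two⊑ {y = two} _         _    = refl
  two⊑ {y = one} (s≤s ()) refl

  separators-represent : ∀ T → Represents (separators T) T
  separators-represent T = record { valid = valid′ ; above = above′ ; below = below′ }
    where
    bound : ∀ j → top j + (bot j ∸ top j) ≡ bot j
    bound j = m+[n∸m]≡n (top≤bot j)
    valid′ : Valid (separators T)
    valid′ j = first-≥ _ (top j) (bot j ∸ top j) ,
               ≤-trans (first-≤ _ (top j) (bot j ∸ top j)) (≤-reflexive (bound j))
    above′ : ∀ {i j} (c : Cell s i j) → i < separators T j → entry T i j c ≡ one
    above′ {i} {j} c i<t = proj₂ (decidable-stable (hasEntry? T i j one)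
      (first-minimal _ (top j) (bot j ∸ top j) i (proj₁ (cell-bounds c)) i<t))
    below′ : ∀ {i j} (c : Cell s i j) → separators T j ≤ i → entry T i j c ≡ two
    below′ {i} {j} c t≤i = two⊑ (down T _ i j cₜ c t≤i)
      (¬one⇒two λ e → first-holds _ (top j) (bot j ∸ top j) (<-≤-trans t<bot (≤-reflexive (sym (bound j)))) (cₜ , e))
      where
      t<bot : separators T j < bot j
      t<bot = ≤-<-trans t≤i (proj₂ (cell-bounds c))
      cₜ : Cell s (separators T j) j
      cₜ = bounds-cell (proj₁ (valid′ j)) t<bot

  -- The contribution of a column to the seplist: the row of its lowest 1, just above the separator.
  -- In a mixed column `t j > top j ≥ 1`, so `pred` does not truncate.
  rows : (ℕ → ℕ) → ℕ → List ℕ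
  rows t j with mix? t j
  ... | yes _ = [ pred (t j) ]
  ... | no  _ = []

  rows-mix : ∀ {t j} → Mix t j → rows t j ≡ [ pred (t j) ]
  rows-mix {t} {j} m with mix? t j
  ... | yes _  = refl
  ... | no  ¬m = contradiction m ¬m

  rows-¬mix : ∀ {t j} → ¬ Mix t j → rows t j ≡ []
  rows-¬mix {t} {j} ¬m with mix? t j
  ... | yes m = contradiction m ¬m
  ... | no  _ = refl

  rows-cong : ∀ {t u j} → t j ≡ u j → rows t j ≡ rows u j
  rows-cong {t} {u} {j} eq with mix? t j
  ... | yes (top<t , t<bot) =
    trans (cong (λ x → [ pred x ]) eq) (sym (rows-mix (subst (top j <_) eq top<t , subst (_< bot j) eq t<bot)))
  ... | no ¬m = sym (rows-¬mix λ (top<u , u<bot) →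
    ¬m (subst (top j <_) (sym eq) top<u , subst (_< bot j) (sym eq) u<bot))

  Decreasing : (ℕ → ℕ) → Set
  Decreasing t = ∀ k → t (suc k) ≤ t k

  Decreasing-≤ : ∀ {t} → Decreasing t → ∀ {j j′} → j ≤ j′ → t j′ ≤ t j
  Decreasing-≤ dec {j} {zero}   z≤n = ≤-refl
  Decreasing-≤ dec {j} {suc j′} j≤j′ with m≤n⇒m<n∨m≡n j≤j′
  ... | inj₁ j<j′ = ≤-trans (dec j′) (Decreasing-≤ dec (s≤s⁻¹ j<j′))
  ... | inj₂ refl = ≤-refl

  module _ {t : ℕ → ℕ} {T : Table s} (rep : Represents t T) where

    has-one : ∀ {i j} → HasEntry T i j one → i < t j
    has-one (c , e) = ≰⇒> λ t≤i → contradiction (trans (sym e) (below rep c t≤i)) λ ()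

    has-two : ∀ {i j} → HasEntry T i j two → t j ≤ i
    has-two (c , e) = ≮⇒≥ λ i<t → contradiction (trans (sym e) (above rep c i<t)) λ ()

    one-cell : ∀ {i j} → top j ≤ i → i < t j → HasEntry T i j one
    one-cell {j = j} top≤i i<t = let c = bounds-cell top≤i (<-≤-trans i<t (proj₂ (valid rep j))) in c , above rep c i<t

    two-cell : ∀ {i j} → t j ≤ i → i < bot j → HasEntry T i j two
    two-cell {j = j} t≤i i<bot = let c = bounds-cell (≤-trans (proj₁ (valid rep j)) t≤i) i<bot in c , below rep c t≤i

    pure-one : ∀ {j} → Pure one T j ⇔ One t j
    pure-one {j} = mk⇔ to from
      where
      to : Pure one T j → One t j
      to ((_ , c) , all-one) = cell-column c ,
        ≤-antisym (proj₂ (valid rep j)) (≮⇒≥ λ t<bot →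
          let c′ , e = two-cell ≤-refl t<bot in contradiction (trans (sym e) (all-one _ c′)) λ ())
      from : One t j → Pure one T j
      from (col , t≡bot) = (_ , column-cell col) ,
        λ i c → above rep c (<-≤-trans (proj₂ (cell-bounds c)) (≤-reflexive (sym t≡bot)))

    pure-two : ∀ {j} → Pure two T j ⇔ Two t j
    pure-two {j} = mk⇔ to from
      where
      to : Pure two T j → Two t j
      to ((_ , c) , all-two) = cell-column c ,
        ≤-antisym (≮⇒≥ λ top<t →
          let c′ , e = one-cell ≤-refl top<t in contradiction (trans (sym e) (all-two _ c′)) λ ())
        (proj₁ (valid rep j))
      from : Two t j → Pure two T j
      from (col , t≡top) = (_ , column-cell col) ,
        λ i c → below rep c (≤-trans (≤-reflexive t≡top) (proj₁ (cell-bounds c)))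

    sep→mix : ∀ {j r} → Sep T j r → Mix t j × t j ≡ r
    sep→mix {j} {r} (((_ , h₁) , _) , h₂@(c , _) , r-least) = (top<t , t<bot) ,
      ≤-antisym (has-two h₂) (r-least _ (two-cell ≤-refl t<bot))
      where
      top<t : top j < t j
      top<t = ≤-<-trans (proj₁ (cell-bounds (proj₁ h₁))) (has-one h₁)
      t<bot : t j < bot j
      t<bot = ≤-<-trans (has-two h₂) (proj₂ (cell-bounds c))

    mix→sep : ∀ {j} → Mix t j → Sep T j (t j)
    mix→sep (top<t , t<bot) = ((_ , one-cell ≤-refl top<t) , (_ , two-cell ≤-refl t<bot)) ,
      two-cell ≤-refl t<bot , λ i h → has-two h

    →descent : ∀ {k} → t k < t (suc k) → Descent T k
    →descent {k} lt = t k ,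
      two-cell ≤-refl (<-≤-trans lt (≤-trans (proj₂ (valid rep (suc k))) (bot-antitone (n≤1+n k)))) ,
      one-cell (≤-trans (top-antitone (n≤1+n k)) (proj₁ (valid rep k))) lt

    isRpp→decreasing : IsRpp T → Decreasing t
    isRpp→decreasing rpp k = ≮⇒≥ λ lt →
      let _ , (c₂ , e₂) , (c₁ , e₁) = →descent lt
      in contradiction (trans (sym e₁) (two⊑ (rpp _ _ _ c₂ c₁ (n≤1+n k)) e₂)) λ ()

    decreasing→isRpp : Decreasing t → IsRpp T
    decreasing→isRpp dec i j j′ c c′ j≤j′ with t j ≤? i
    ... | yes t≤i rewrite below rep c t≤i | below rep c′ (≤-trans (Decreasing-≤ dec j≤j′) t≤i) = ≤-refl
    ... | no  t≰i rewrite above rep c (≰⇒> t≰i) with entry T i j′ c′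
    ...   | one = ≤-refl
    ...   | two = s≤s z≤n

    seplist-rows : seplist T ≡ concat< (rows t) (suc (width s))
    seplist-rows = begin
      concatMap rowsOf (interval 1 (suc (width s)))           ≡⟨ concatMap-applyUpTo rowsOf suc (width s) ⟩
      concat< (λ j → rowsOf (suc j)) (width s)                ≡⟨ Concat.prefix-cong (width s) (λ j _ → rowsOf-rows (suc j)) ⟩
      concat< (λ j → rows t (suc j)) (width s)
        -- The scan starts at column 1; the empty column 0 is put in front so that positions and
        -- column numbers agree.
        ≡⟨ cong (_++ concat< (λ j → rows t (suc j)) (width s)) (rows-¬mix {t} ¬mix-0) ⟨
      concat< (rows t) 1 ++ concat< (λ j → rows t (suc j)) (width s)
        ≡⟨ Concat.prefix-+ (rows t) 1 (width s) ⟨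
      concat< (rows t) (suc (width s))                        ∎
      where
      open ≡-Reasoning
      rowsOf : ℕ → List ℕ
      rowsOf j = filter (λ i → sepCell? T i j) (interval 1 (suc (height s)))

      ¬mix-0 : ¬ Mix t 0
      ¬mix-0 m = contradiction (proj₁ (column-range (mix-column {t} m))) λ ()

      sepCell→ : ∀ {i j} → HasEntry T i j one × HasEntry T (suc i) j two → Mix t j × suc i ≡ t j
      sepCell→ {i} {j} (h₁ , h₂) = (≤-<-trans (proj₁ (cell-bounds (proj₁ h₁))) (has-one h₁) ,
         ≤-<-trans (has-two h₂) (proj₂ (cell-bounds (proj₁ h₂)))) , ≤-antisym (has-one h₁) (has-two h₂)

      -- The value of `t j` is generalised to `y` in order to match on it: the values 0 and 1 are
      -- excluded by `top j ≥ 1`, and `suc (suc i)` gives the row `suc i` of the last 1.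
      rowsOf-mix : ∀ {j} y → t j ≡ y → Mix t j → rowsOf j ≡ [ pred y ]
      rowsOf-mix zero eq (top<t , _) = contradiction (<-≤-trans top<t (≤-reflexive eq)) λ ()
      rowsOf-mix {j} (suc zero) eq (top<t , _) =
        contradiction (≤-trans (≤-<-trans (top≥1 j) top<t) (≤-reflexive eq)) λ { (s≤s ()) }
      rowsOf-mix {j} (suc (suc i)) eq (top<t , t<bot) = begin
        rowsOf j
          ≡⟨ filter-applyUpTo (λ i → sepCell? T i j) suc (height s) ⟩
        concat< (λ i → filter (λ i → sepCell? T i j) [ suc i ]) (height s)
          ≡⟨ Concat.prefix-single i (height s) i<height (λ i′ i′≢i →
               filter-reject (λ i → sepCell? T i j) λ h →
                 i′≢i (suc-injective (suc-injective (trans (proj₂ (sepCell→ h)) eq)))) ⟩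
        filter (λ i → sepCell? T i j) [ suc i ]
          ≡⟨ filter-accept (λ i → sepCell? T i j) (h₁ , h₂) ⟩
        [ suc i ] ∎
        where
        h₁ : HasEntry T (suc i) j one
        h₁ = one-cell (s≤s⁻¹ (<-≤-trans top<t (≤-reflexive eq))) (≤-reflexive (sym eq))
        h₂ : HasEntry T (suc (suc i)) j two
        h₂ = two-cell (≤-reflexive eq) (≤-<-trans (≤-reflexive (sym eq)) t<bot)
        i<height : i < height s
        i<height = <-trans ≤-refl (row≤height s (proj₁ h₂))

      rowsOf-rows : ∀ j → rowsOf j ≡ rows t j
      rowsOf-rows j with mix? t j
      ... | yes m = rowsOf-mix (t j) refl m
      ... | no ¬m = trans (filter-applyUpTo (λ i → sepCell? T i j) suc (height s))
        (Concat.prefix-ε (height s) λ i _ → filter-reject (λ i → sepCell? T i j) (¬m ∘ proj₁ ∘ sepCell→))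

  separators-≈ : ∀ {t u T U} → Represents t T → Represents u U → (∀ j → t j ≡ u j) → T ≈ᵗ U
  separators-≈ {t} {u} repT repU t≗u i j c with t j ≤? i
  ... | yes t≤i = trans (below repT c t≤i) (sym (below repU c (≤-trans (≤-reflexive (sym (t≗u j))) t≤i)))
  ... | no  t≰i = trans (above repT c (≰⇒> t≰i)) (sym (above repU c (<-≤-trans (≰⇒> t≰i) (≤-reflexive (t≗u j)))))

  ≈-represents : ∀ {t T U} → T ≈ᵗ U → Represents t T → Represents t U
  ≈-represents T≈U rep = record
    { valid = valid rep
    ; above = λ c i<t → trans (sym (T≈U _ _ c)) (above rep c i<t)
    ; below = λ c t≤i → trans (sym (T≈U _ _ c)) (below rep c t≤i)
    }

  flipSeparators : (ℕ → ℕ) → ℕ → ℕ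
  flipSeparators t j with t j ≟ bot j | t j ≟ top j
  ... | yes _ | _     = top j
  ... | no  _ | yes _ = bot j
  ... | no  _ | no  _ = t j

  flip-valid : ∀ {t} → Valid t → Valid (flipSeparators t)
  flip-valid {t} valid j with t j ≟ bot j | t j ≟ top j
  ... | yes _ | _     = ≤-refl , top≤bot j
  ... | no  _ | yes _ = top≤bot j , ≤-refl
  ... | no  _ | no  _ = valid j

  flip-one : ∀ {t j} → One (flipSeparators t) j ⇔ Two t j
  flip-one {t} {j} = mk⇔ to from
    where
    to : One (flipSeparators t) j → Two t j
    to (col , eq) with t j ≟ bot j | t j ≟ top j
    ... | yes _     | _         = contradiction eq (<⇒≢ col)
    ... | no  _     | yes t≡top = col , t≡top
    ... | no  t≢bot | no  _     = contradiction eq t≢bot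
    from : Two t j → One (flipSeparators t) j
    from (col , t≡top) with t j ≟ bot j | t j ≟ top j
    ... | yes t≡bot | _        = contradiction (trans (sym t≡top) t≡bot) (<⇒≢ col)
    ... | no  _     | yes _    = col , refl
    ... | no  _     | no t≢top = contradiction t≡top t≢top

  flip-two : ∀ {t j} → Two (flipSeparators t) j ⇔ One t j
  flip-two {t} {j} = mk⇔ to from
    where
    to : Two (flipSeparators t) j → One t j
    to (col , eq) with t j ≟ bot j | t j ≟ top j
    ... | yes t≡bot | _         = col , t≡bot
    ... | no  _     | yes _     = contradiction (sym eq) (<⇒≢ col)
    ... | no  _     | no  t≢top = contradiction eq t≢top
    from : One t j → Two (flipSeparators t) j
    from (col , t≡bot) with t j ≟ bot j | t j ≟ top j
    ... | yes _     | _        = col , refl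
    ... | no  t≢bot | _        = contradiction t≡bot t≢bot

  flip-mix : ∀ {t j} → Mix (flipSeparators t) j → Mix t j × flipSeparators t j ≡ t j
  flip-mix {t} {j} (top<t , t<bot) with t j ≟ bot j | t j ≟ top j
  ... | yes _ | _     = contradiction top<t (<-irrefl refl)
  ... | no  _ | yes _ = contradiction t<bot (<-irrefl refl)
  ... | no  _ | no  _ = (top<t , t<bot) , refl

  mix-flip : ∀ {t j} → Mix t j → flipSeparators t j ≡ t j
  mix-flip {t} {j} (top<t , t<bot) with t j ≟ bot j | t j ≟ top j
  ... | yes eq | _      = contradiction eq (<⇒≢ t<bot)
  ... | no  _  | yes eq = contradiction (sym eq) (<⇒≢ top<t)
  ... | no  _  | no  _  = refl

  rows-flip : ∀ t j → rows (flipSeparators t) j ≡ rows t j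
  rows-flip t j with mix? (flipSeparators t) j
  ... | yes m = let m′ , eq = flip-mix {t} m in trans (cong (λ x → [ pred x ]) eq) (sym (rows-mix m′))
  ... | no ¬m = sym (rows-¬mix λ m → ¬m (subst (λ x → top j < x × x < bot j) (sym (mix-flip {t} m)) m))

  flip-represents : ∀ {t T} → Represents t T → Represents (flipSeparators t) (flip T)
  flip-represents {t} {T} rep = record { valid = flip-valid (valid rep) ; above = above′ ; below = below′ }
    where
    open Equivalence
    above′ : ∀ {i j} (c : Cell s i j) → i < flipSeparators t j → entry (flip T) i j c ≡ one
    above′ {i} {j} c i<t with pure? one T j | pure? two T j | t j ≟ bot j | t j ≟ top j
    ... | yes _  | _      | yes _     | _        = contradiction i<t (≤⇒≯ (proj₁ (cell-bounds c)))
    ... | yes p₁ | _      | no t≢bot  | _        = contradiction (proj₂ (to (pure-one rep) p₁)) t≢bot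
    ... | no ¬p₁ | _      | yes t≡bot | _        = contradiction (from (pure-one rep) (cell-column c , t≡bot)) ¬p₁
    ... | no _   | yes _  | no _      | _        = refl
    ... | no _   | no ¬p₂ | no _      | yes t≡top = contradiction (from (pure-two rep) (cell-column c , t≡top)) ¬p₂
    ... | no _   | no _   | no _      | no _     = above rep c i<t
    below′ : ∀ {i j} (c : Cell s i j) → flipSeparators t j ≤ i → entry (flip T) i j c ≡ two
    below′ {i} {j} c t≤i with pure? one T j | pure? two T j | t j ≟ bot j | t j ≟ top j
    ... | yes _  | _      | _         | _        = refl
    ... | no ¬p₁ | _      | yes t≡bot | _        = contradiction (from (pure-one rep) (cell-column c , t≡bot)) ¬p₁
    ... | no _   | yes p₂ | no _      | no t≢top = contradiction (proj₂ (to (pure-two rep) p₂)) t≢top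
    ... | no _   | yes _  | no _      | yes _    = contradiction t≤i (<⇒≱ (proj₂ (cell-bounds c)))
    ... | no _   | no ¬p₂ | no _      | yes t≡top = contradiction (from (pure-two rep) (cell-column c , t≡top)) ¬p₂
    ... | no _   | no _   | no _      | no _     = below rep c t≤i

-- Resolution of descents and its termination

module Resolution (s : SkewPartition) where

  open Columns s
  open Separators s
  open Represents
  open Equivalence

  -- If `u j < t j`, the cell in row `u j` would be 1 in `T` and 2 in `U`. This lets statements
  -- about separators be applied to the arbitrary tables that occur along a resolution path.
  separators-unique : ∀ {t u T U} → Represents t T → Represents u U →
    ∀ j → (∀ i (c : Cell s i j) → entry T i j c ≡ entry U i j c) → t j ≡ u j
  separators-unique repT repU j T≗U = ≤-antisym (go repT repU T≗U) (go repU repT λ i c → sym (T≗U i c))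
    where
    go : ∀ {t u T U} → Represents t T → Represents u U →
         (∀ i (c : Cell s i j) → entry T i j c ≡ entry U i j c) → t j ≤ u j
    go repT repU T≗U = ≮⇒≥ λ u<t →
      let c , e = one-cell repT (proj₁ (valid repU j)) u<t
      in contradiction (trans (sym e) (trans (T≗U _ c) (below repU c ≤-refl))) λ ()

  data Moved (k : ℕ) (t u : ℕ → ℕ) : Set where
    mixed-pure1 : Mix t k → One t (suc k) → One u k → Mix u (suc k) → u (suc k) ≡ t k → Moved k t u
    pure2-mixed : Two t k → Mix t (suc k) → Mix u k → Two u (suc k) → u k ≡ t (suc k) → Moved k t u
    pure2-pure1 : Two t k → One t (suc k) → One u k → Two u (suc k) → Moved k t u

  record Step (k : ℕ) (t u : ℕ → ℕ) : Set where
    field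
      unmoved : ∀ j → j ≢ k → j ≢ suc k → u j ≡ t j
      moved   : Moved k t u

  open Step

  resolves→step : ∀ {k t u P Q} → Represents t P → Represents u Q → Resolves k P Q → Step k t u
  resolves→step {k} {t} {u} {P} {Q} repP repQ res = record
    { unmoved = λ j j≢k j≢1+k → separators-unique repQ repP j λ i c → Resolves.elsewhere res i j c j≢k j≢1+k
    ; moved   = move (Resolves.columns res)
    }
    where
    move : ResolvedColumns k P Q → Moved k t u
    move (mixed-pure1 sepP p₁ q₁ sepQ) with sep→mix repP sepP | sep→mix repQ sepQ
    ... | m , eq | m′ , eq′ = mixed-pure1 m (to (pure-one repP) p₁) (to (pure-one repQ) q₁) m′ (trans eq′ (sym eq))
    move (pure2-mixed p₂ sepP sepQ q₂) with sep→mix repP sepP | sep→mix repQ sepQ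
    ... | m , eq | m′ , eq′ = pure2-mixed (to (pure-two repP) p₂) m m′ (to (pure-two repQ) q₂) (trans eq′ (sym eq))
    move (pure2-pure1 p₂ p₁ q₁ q₂) = pure2-pure1 (to (pure-two repP) p₂) (to (pure-one repP) p₁)
      (to (pure-one repQ) q₁) (to (pure-two repQ) q₂)

  SepsDecrease : (ℕ → ℕ) → Set
  SepsDecrease t = ∀ {k l} → k < l → Mix t k → Mix t l → t l ≤ t k

  sepsDecrease→benign : ∀ {t T} → Represents t T → SepsDecrease t → Benign T
  sepsDecrease→benign rep dec k l r r′ k<l sepₖ sepₗ with sep→mix rep sepₖ | sep→mix rep sepₗ
  ... | m , refl | m′ , refl = dec k<l m m′

  step→resolves : ∀ {k t u P Q} → Represents t P → Represents u Q →
    SepsDecrease t → SepsDecrease u → t k < t (suc k) → Step k t u → Resolves k P Q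
  step→resolves {k} {t} {u} {P} {Q} repP repQ dec-t dec-u t<t step = record
    { benignP   = sepsDecrease→benign repP dec-t
    ; descent   = →descent repP t<t
    ; benignQ   = sepsDecrease→benign repQ dec-u
    ; elsewhere = same
    ; columns   = resolved (moved step)
    }
    where
    same : ∀ i j (c : Cell s i j) → j ≢ k → j ≢ suc k → entry Q i j c ≡ entry P i j c
    same i j c j≢k j≢1+k with t j ≤? i
    ... | yes t≤i = trans (below repQ c (≤-trans (≤-reflexive (unmoved step j j≢k j≢1+k)) t≤i)) (sym (below repP c t≤i))
    ... | no  t≰i = trans (above repQ c (<-≤-trans (≰⇒> t≰i) (≤-reflexive (sym (unmoved step j j≢k j≢1+k)))))
                          (sym (above repP c (≰⇒> t≰i)))
    resolved : Moved k t u → ResolvedColumns k P Q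
    resolved (mixed-pure1 m o o′ m′ eq) = mixed-pure1 (mix→sep repP m) (from (pure-one repP) o)
      (from (pure-one repQ) o′) (subst (Sep Q (suc k)) eq (mix→sep repQ m′))
    resolved (pure2-mixed w m m′ w′ eq) = pure2-mixed (from (pure-two repP) w) (mix→sep repP m)
      (subst (Sep Q k) eq (mix→sep repQ m′)) (from (pure-two repQ) w′)
    resolved (pure2-pure1 w o o′ w′) = pure2-pure1 (from (pure-two repP) w) (from (pure-one repP) o)
      (from (pure-one repQ) o′) (from (pure-two repQ) w′)

  mix-cong : ∀ {t u j} → t j ≡ u j → Mix t j → Mix u j
  mix-cong {j = j} eq = subst (λ x → top j < x × x < bot j) eq

  -- A mixed column and a pure one change places and the separator travels along unchanged, so the
  -- sequence of separators of mixed columns is the same before and after. The cases trace the two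
  -- mixed columns of `u` back to `t`.
  step-sepsDecrease : ∀ {k t u} → SepsDecrease t → Step k t u → SepsDecrease u
  step-sepsDecrease {k} {t} {u} dec step {i} {j} i<j mᵢ mⱼ = go (moved step) (i ≟ k) (i ≟ suc k) (j ≟ k) (j ≟ suc k)
    where
    back : ∀ {j} → j ≢ k → j ≢ suc k → Mix u j → Mix t j
    back j≢k j≢1+k = mix-cong {u} {t} (unmoved step _ j≢k j≢1+k)
    same : ∀ {j} → j ≢ k → j ≢ suc k → u j ≡ t j
    same = unmoved step _
    go : Moved k t u → Dec (i ≡ k) → Dec (i ≡ suc k) → Dec (j ≡ k) → Dec (j ≡ suc k) → u j ≤ u i
    go _ (no i≢k) (no i≢1+k) (no j≢k) (no j≢1+k) =
      subst₂ _≤_ (sym (same j≢k j≢1+k)) (sym (same i≢k i≢1+k)) (dec i<j (back i≢k i≢1+k mᵢ) (back j≢k j≢1+k mⱼ))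
    go (mixed-pure1 _ _ o _ _) (yes refl) _ _ _ = contradiction mᵢ (one≢mix {u} o)
    go (mixed-pure1 _ _ o _ _) _ _ (yes refl) _ = contradiction mⱼ (one≢mix {u} o)
    go (mixed-pure1 m _ _ _ eq) _ (yes refl) (no j≢k) (no j≢1+k) =
      subst₂ _≤_ (sym (same j≢k j≢1+k)) (sym eq) (dec (<-trans ≤-refl i<j) m (back j≢k j≢1+k mⱼ))
    go (mixed-pure1 m _ _ _ eq) (no i≢k) (no i≢1+k) _ (yes refl) =
      subst₂ _≤_ (sym eq) (sym (same i≢k i≢1+k)) (dec (≤∧≢⇒< (s≤s⁻¹ i<j) i≢k) (back i≢k i≢1+k mᵢ) m)
    go (mixed-pure1 _ _ _ _ _) _ (yes refl) _ (yes refl) = contradiction i<j (<-irrefl refl)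
    go (pure2-mixed _ _ _ w _) _ (yes refl) _ _ = contradiction mᵢ (two≢mix {u} w)
    go (pure2-mixed _ _ _ w _) _ _ _ (yes refl) = contradiction mⱼ (two≢mix {u} w)
    go (pure2-mixed _ m _ _ eq) (yes refl) _ (no j≢k) (no j≢1+k) =
      subst₂ _≤_ (sym (same j≢k j≢1+k)) (sym eq) (dec (≤∧≢⇒< i<j (j≢1+k ∘ sym)) m (back j≢k j≢1+k mⱼ))
    go (pure2-mixed _ m _ _ eq) (no i≢k) (no i≢1+k) (yes refl) _ =
      subst₂ _≤_ (sym eq) (sym (same i≢k i≢1+k)) (dec (m<n⇒m<1+n i<j) (back i≢k i≢1+k mᵢ) m)
    go (pure2-mixed _ _ _ _ _) (yes refl) _ (yes refl) _ = contradiction i<j (<-irrefl refl)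
    go (pure2-pure1 _ _ o _) (yes refl) _ _ _ = contradiction mᵢ (one≢mix {u} o)
    go (pure2-pure1 _ _ o _) _ _ (yes refl) _ = contradiction mⱼ (one≢mix {u} o)
    go (pure2-pure1 _ _ _ w) _ (yes refl) _ _ = contradiction mᵢ (two≢mix {u} w)
    go (pure2-pure1 _ _ _ w) _ _ _ (yes refl) = contradiction mⱼ (two≢mix {u} w)

  replace₂ : ℕ → ℕ → ℕ → (ℕ → ℕ) → ℕ → ℕ
  replace₂ k x y t j with j ≟ k | j ≟ suc k
  ... | yes _ | _     = x
  ... | no  _ | yes _ = y
  ... | no  _ | no  _ = t j

  replace₂-at : ∀ k x y t → replace₂ k x y t k ≡ x
  replace₂-at k x y t with k ≟ k
  ... | yes _  = refl
  ... | no k≢k = contradiction refl k≢k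

  replace₂-at-suc : ∀ k x y t → replace₂ k x y t (suc k) ≡ y
  replace₂-at-suc k x y t with suc k ≟ k | suc k ≟ suc k
  ... | yes 1+k≡k | _ = contradiction 1+k≡k (<⇒≢ ≤-refl ∘ sym)
  ... | no  _     | yes _ = refl
  ... | no  _     | no ≢  = contradiction refl ≢

  replace₂-elsewhere : ∀ k x y t j → j ≢ k → j ≢ suc k → replace₂ k x y t j ≡ t j
  replace₂-elsewhere k x y t j j≢k j≢1+k with j ≟ k | j ≟ suc k
  ... | yes j≡k | _         = contradiction j≡k j≢k
  ... | no  _   | yes j≡1+k = contradiction j≡1+k j≢1+k
  ... | no  _   | no  _     = refl

  replace₂-valid : ∀ {k x y t} → Valid t → top k ≤ x × x ≤ bot k → top (suc k) ≤ y × y ≤ bot (suc k) →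
                   Valid (replace₂ k x y t)
  replace₂-valid {k} valid-t x-ok y-ok j with j ≟ k | j ≟ suc k
  ... | yes refl | _        = x-ok
  ... | no  _    | yes refl = y-ok
  ... | no  _    | no  _    = valid-t j

  descent-columns : ∀ {t k} → Valid t → t k < t (suc k) → Column k × Column (suc k)
  descent-columns {t} {k} valid-t t<t =
    <-≤-trans top<bot′ (bot-antitone (n≤1+n k)) , ≤-<-trans (top-antitone (n≤1+n k)) top<bot′
    where
    top<bot′ : top k < bot (suc k)
    top<bot′ = ≤-<-trans (proj₁ (valid-t k)) (<-≤-trans t<t (proj₂ (valid-t (suc k))))

  -- At a descent, column `k` is not 1-pure because bottoms weakly decrease, column `suc k` is not
  -- 2-pure because tops do, and not both are mixed by `SepsDecrease`. In the remaining cases with a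
  -- mixed column, the descent supplies the missing bound that keeps the transported separator
  -- strictly inside its new column.
  resolve : ∀ {t k} → Valid t → SepsDecrease t → t k < t (suc k) → ∃ λ u → Valid u × Step k t u
  resolve {t} {k} valid-t dec t<t = go (kind valid-t col) (kind valid-t col′)
    where
    col = proj₁ (descent-columns valid-t t<t)
    col′ = proj₂ (descent-columns valid-t t<t)
    top-≤ = top-antitone (n≤1+n k)
    bot-≤ = bot-antitone (n≤1+n k)

    result : ∀ x y → top k ≤ x × x ≤ bot k → top (suc k) ≤ y × y ≤ bot (suc k) →
             (replace₂ k x y t k ≡ x → replace₂ k x y t (suc k) ≡ y → Moved k t (replace₂ k x y t)) →
             ∃ λ u → Valid u × Step k t u
    result x y x-ok y-ok move = replace₂ k x y t , replace₂-valid valid-t x-ok y-ok , record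
      { unmoved = replace₂-elsewhere k x y t
      ; moved   = move (replace₂-at k x y t) (replace₂-at-suc k x y t)
      }

    go : Kind t k → Kind t (suc k) → ∃ λ u → Valid u × Step k t u
    go (isOne (_ , t≡bot)) _ = contradiction t<t
      (≤⇒≯ (≤-trans (proj₂ (valid-t (suc k))) (≤-trans bot-≤ (≤-reflexive (sym t≡bot)))))
    go _ (isTwo (_ , t≡top)) = contradiction t<t
      (≤⇒≯ (≤-trans (≤-reflexive t≡top) (≤-trans top-≤ (proj₁ (valid-t k)))))
    go (isMix m) (isMix m′) = contradiction t<t (≤⇒≯ (dec ≤-refl m m′))
    go (isMix m@(top<t , _)) (isOne o@(_ , t≡bot)) =
      result (bot k) (t k) (top≤bot k , ≤-refl) (<⇒≤ top′<t , <⇒≤ t<bot′) λ eq eq′ →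
        mixed-pure1 m o (col , eq) (subst (top (suc k) <_) (sym eq′) top′<t , subst (_< bot (suc k)) (sym eq′) t<bot′) eq′
      where
      top′<t = ≤-<-trans top-≤ top<t
      t<bot′ = <-≤-trans t<t (≤-reflexive t≡bot)
    go (isTwo w@(_ , t≡top)) (isMix m@(_ , t<bot)) =
      result (t (suc k)) (top (suc k)) (<⇒≤ top<t′ , <⇒≤ t′<bot) (≤-refl , top≤bot (suc k)) λ eq eq′ →
        pure2-mixed w m (subst (top k <_) (sym eq) top<t′ , subst (_< bot k) (sym eq) t′<bot) (col′ , eq′) eq
      where
      top<t′ = ≤-<-trans (≤-reflexive (sym t≡top)) t<t
      t′<bot = <-≤-trans t<bot bot-≤
    go (isTwo w) (isOne o) =
      result (bot k) (top (suc k)) (top≤bot k , ≤-refl) (≤-refl , top≤bot (suc k)) λ eq eq′ →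
        pure2-pure1 w o (col , eq) (col′ , eq′)

  -- The value is 0, 1 or 2 for a 1-pure, mixed or 2-pure column. A resolution exchanges a heavier
  -- column with a lighter right neighbour.
  weight : (ℕ → ℕ) → ℕ → ℕ
  weight t j = indicator (t j <? bot j) + indicator (t j ≤? top j)

  weight-one : ∀ {t j} → One t j → weight t j ≡ 0
  weight-one {t} {j} (col , t≡bot) = cong₂ _+_
    (indicator-false (t j <? bot j) λ t<bot → <⇒≢ t<bot t≡bot)
    (indicator-false (t j ≤? top j) λ t≤top → <⇒≱ col (≤-trans (≤-reflexive (sym t≡bot)) t≤top))

  weight-mix : ∀ {t j} → Mix t j → weight t j ≡ 1
  weight-mix {t} {j} (top<t , t<bot) = cong₂ _+_
    (indicator-true (t j <? bot j) t<bot) (indicator-false (t j ≤? top j) (<⇒≱ top<t))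

  weight-two : ∀ {t j} → Two t j → weight t j ≡ 2
  weight-two {t} {j} (col , t≡top) = cong₂ _+_
    (indicator-true (t j <? bot j) (≤-<-trans (≤-reflexive t≡top) col))
    (indicator-true (t j ≤? top j) (≤-reflexive t≡top))

  step-weight : ∀ {k t u} → Step k t u →
    weight u k < weight t k × weight u k + weight u (suc k) ≡ weight t k + weight t (suc k)
  step-weight {k} {t} {u} step with moved step
  ... | mixed-pure1 m o o′ m′ _
    rewrite weight-mix {t} m | weight-one {t} o | weight-one {u} o′ | weight-mix {u} m′ = s≤s z≤n , refl
  ... | pure2-mixed w m m′ w′ _
    rewrite weight-two {t} w | weight-mix {t} m | weight-mix {u} m′ | weight-two {u} w′ = s≤s (s≤s z≤n) , refl
  ... | pure2-pure1 w o o′ w′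
    rewrite weight-two {t} w | weight-one {t} o | weight-one {u} o′ | weight-two {u} w′ = s≤s z≤n , refl

  -- As weight moves to the right, the prefix sum that ends between the two columns drops and all
  -- others stay. The sum of the prefix sums therefore decreases.
  potential : (ℕ → ℕ) → ℕ
  potential t = sum< (sum< (weight t)) (suc (suc (width s)))

  step-column : ∀ {k t u} → Step k t u → Column k × Column (suc k)
  step-column {t = t} step with moved step
  ... | mixed-pure1 m o _ _ _ = mix-column {t} m , proj₁ o
  ... | pure2-mixed w m _ _ _ = proj₁ w , mix-column {t} m
  ... | pure2-pure1 w o _ _   = proj₁ w , proj₁ o

  weight-cong : ∀ {t u j} → t j ≡ u j → weight t j ≡ weight u j
  weight-cong {j = j} = cong (λ x → indicator (x <? bot j) + indicator (x ≤? top j))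

  step-potential : ∀ {k t u} → Step k t u → potential u < potential t
  step-potential {k} {t} {u} step =
    sum<-mono-< sums≤ (suc (suc (width s))) (s≤s (s≤s (<⇒≤ (proj₂ (column-range (proj₂ (step-column step))))))) sum-at
    where
    agree : ∀ n → n ≢ suc k → sum< (weight u) n ≡ sum< (weight t) n
    agree = sum<-swap k (λ j j≢k j≢1+k → weight-cong {u} {t} (unmoved step j j≢k j≢1+k)) (proj₂ (step-weight step))
    sum-at : sum< (weight u) (suc k) < sum< (weight t) (suc k)
    sum-at = +-mono-≤-< (≤-reflexive (agree k (<⇒≢ ≤-refl))) (proj₁ (step-weight step))
    sums≤ : ∀ n → sum< (weight u) n ≤ sum< (weight t) n
    sums≤ n with n ≟ suc k
    ... | yes refl = <⇒≤ sum-at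
    ... | no  n≢   = ≤-reflexive (agree n n≢)

  -- A descent requires two nonempty columns, which bounds the search by the width.
  descent? : ∀ {t} → Valid t → (∃ λ k → t k < t (suc k)) ⊎ Decreasing t
  descent? {t} valid-t with anyUpTo? (λ k → t k <? t (suc k)) (suc (width s))
  ... | yes (k , _ , t<t) = inj₁ (k , t<t)
  ... | no  none = inj₂ λ k → ≮⇒≥ λ t<t →
    none (k , m<n⇒m<1+n (proj₂ (column-range (proj₂ (descent-columns valid-t t<t)))) , t<t)

  normalise : ∀ {t T} → Represents t T → SepsDecrease t →
    ∃₂ λ u U → Represents u U × Decreasing u × Star _↝_ T U
  normalise {t} {T} rep dec = go rep dec (<-wellFounded (potential t))
    where
    go : ∀ {t T} → Represents t T → SepsDecrease t → Acc _<_ (potential t) →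
         ∃₂ λ u U → Represents u U × Decreasing u × Star _↝_ T U
    go {t} {T} rep dec (acc smaller) with descent? (valid rep)
    ... | inj₂ decreasing = t , T , rep , decreasing , nil
    ... | inj₁ (k , t<t) =
      let u , valid-u , step = resolve (valid rep) dec t<t
          dec-u = step-sepsDecrease dec step
          rep-u = fromSeparators-represents valid-u
          v , V , rep-v , decreasing , path = go rep-u dec-u (smaller (step-potential step))
      in v , V , rep-v , decreasing , (k , step→resolves rep rep-u dec dec-u t<t step) ◅ path

-- Supermodularity of counting

length-filter-∷ : ∀ {P : ℕ → Set} (P? : Decidable P) x xs →
  length (filter P? (x ∷ xs)) ≡ indicator (P? x) + length (filter P? xs)
length-filter-∷ P? x xs with does (P? x)
... | true  = refl
... | false = refl

-- Holds entry by entry: membership in `A` or `B` is paid for by `C`, and the second unit for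
-- membership in both by `D`. It is applied to two intervals, their union and their intersection.
length-filter-supermodular : ∀ {A B C D : ℕ → Set}
  (A? : Decidable A) (B? : Decidable B) (C? : Decidable C) (D? : Decidable D) →
  (∀ {i} → A i → C i) → (∀ {i} → B i → C i) → (∀ {i} → A i → B i → D i) → ∀ xs →
  length (filter A? xs) + length (filter B? xs) ≤ length (filter C? xs) + length (filter D? xs)
length-filter-supermodular A? B? C? D? A⇒C B⇒C A∧B⇒D [] = z≤n
length-filter-supermodular A? B? C? D? A⇒C B⇒C A∧B⇒D (x ∷ xs) = begin
  length (filter A? (x ∷ xs)) + length (filter B? (x ∷ xs))
    ≡⟨ cong₂ _+_ (length-filter-∷ A? x xs) (length-filter-∷ B? x xs) ⟩
  (indicator (A? x) + length (filter A? xs)) + (indicator (B? x) + length (filter B? xs))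
    ≡⟨ interchange (indicator (A? x)) _ _ _ ⟩
  (indicator (A? x) + indicator (B? x)) + (length (filter A? xs) + length (filter B? xs))
    ≤⟨ +-mono-≤ at-x (length-filter-supermodular A? B? C? D? A⇒C B⇒C A∧B⇒D xs) ⟩
  (indicator (C? x) + indicator (D? x)) + (length (filter C? xs) + length (filter D? xs))
    ≡⟨ interchange (indicator (C? x)) _ _ _ ⟩
  (indicator (C? x) + length (filter C? xs)) + (indicator (D? x) + length (filter D? xs))
    ≡⟨ cong₂ _+_ (length-filter-∷ C? x xs) (length-filter-∷ D? x xs) ⟨
  length (filter C? (x ∷ xs)) + length (filter D? (x ∷ xs)) ∎
  where
  open ≤-Reasoning
  interchange : ∀ a b c d → (a + b) + (c + d) ≡ (a + c) + (b + d)
  interchange = solve 4 (λ a b c d → (a :+ b) :+ (c :+ d) := (a :+ c) :+ (b :+ d)) refl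
    where open +-*-Solver
  at-x : indicator (A? x) + indicator (B? x) ≤ indicator (C? x) + indicator (D? x)
  at-x with A? x | B? x
  ... | no  _ | no  _ = z≤n
  ... | yes a | no  _ rewrite indicator-true (C? x) (A⇒C a) = s≤s z≤n
  ... | no  _ | yes b rewrite indicator-true (C? x) (B⇒C b) = s≤s z≤n
  ... | yes a | yes b rewrite indicator-true (C? x) (A⇒C a) | indicator-true (D? x) (A∧B⇒D a b) = ≤-refl

∸-exchange : ∀ {x p z q} → x ≤ p → p ≤ z → z ≤ q → (z ∸ x) + (q ∸ p) ≡ (q ∸ x) + (z ∸ p)
∸-exchange {x} {p} {z} {q} x≤p p≤z z≤q = begin
  (z ∸ x) + (q ∸ p)                     ≡⟨ cong ((z ∸ x) +_) (∸-split p≤z z≤q) ⟨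
  (z ∸ x) + ((z ∸ p) + (q ∸ z))         ≡⟨ cong ((z ∸ x) +_) (+-comm (z ∸ p) (q ∸ z)) ⟩
  (z ∸ x) + ((q ∸ z) + (z ∸ p))         ≡⟨ +-assoc (z ∸ x) (q ∸ z) (z ∸ p) ⟨
  ((z ∸ x) + (q ∸ z)) + (z ∸ p)         ≡⟨ cong (_+ (z ∸ p)) (∸-split (≤-trans x≤p p≤z) z≤q) ⟩
  (q ∸ x) + (z ∸ p)                     ∎
  where
  open ≡-Reasoning
  ∸-split : ∀ {a b c} → a ≤ b → b ≤ c → (b ∸ a) + (c ∸ b) ≡ c ∸ a
  ∸-split {a} {b} {c} a≤b b≤c = begin
    (b ∸ a) + (c ∸ b)   ≡⟨ +-∸-comm (c ∸ b) a≤b ⟨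
    b + (c ∸ b) ∸ a     ≡⟨ cong (_∸ a) (m+[n∸m]≡n b≤c) ⟩
    c ∸ a               ∎

-- Tight intervals, and the uniqueness of a 12-rpp with given counts

module Counting (s : SkewPartition) (connected : Connected s) (noEmpty : NoEmptyColumns s)
                (ν : Partition) (representable : Representable s ν) where

  open Columns s
  open Separators s
  open Resolution s
  open Represents

  private
    N : ℕ
    N = suc (width s)

  column<N : ∀ {j} → Column j → j < N
  column<N col = s≤s (proj₂ (column-range col))

  -- Extends representability to `a ≡ b`: an admissible entry has nonempty support, so none fits
  -- into an empty interval.
  #within-≤ : ∀ {a b} → a ≤ b → #within s ν a b ≤ b ∸ a
  #within-≤ {a} {b} a≤b with m≤n⇒m<n∨m≡n a≤b
  ... | inj₁ a<b  = proj₂ representable a b a<b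
  ... | inj₂ refl = ≤-reflexive (trans
    (cong length (filter-none (suppWithin? s a a) (All.map ¬within (proj₁ representable)))) (sym (n∸n≡0 a)))
    where
    ¬within : ∀ {i} → (∃ λ j → Supp s i j) → ¬ SuppWithin s a a i
    ¬within (j , supp) within = let a≤j , j<a = within j supp in <⇒≱ j<a a≤j

  IsTight : ℕ → ℕ → Set
  IsTight a b = #within s ν a b ≡ b ∸ a

  -- The number of entries supported in an interval is supermodular in the interval.
  tight-union : ∀ {x p z q} → x ≤ p → p ≤ z → z ≤ q → IsTight x z → IsTight p q → IsTight x q
  tight-union {x} {p} {z} {q} x≤p p≤z z≤q tight₁ tight₂ =
    ≤-antisym (#within-≤ (≤-trans x≤p (≤-trans p≤z z≤q))) (+-cancelʳ-≤ (z ∸ p) (q ∸ x) (#within s ν x q) (begin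
      (q ∸ x) + (z ∸ p)                       ≡⟨ ∸-exchange x≤p p≤z z≤q ⟨
      (z ∸ x) + (q ∸ p)                       ≡⟨ cong₂ _+_ tight₁ tight₂ ⟨
      #within s ν x z + #within s ν p q       ≤⟨ length-filter-supermodular
        (suppWithin? s x z) (suppWithin? s p q) (suppWithin? s x q) (suppWithin? s p z)
        (λ w j supp → let l , h = w j supp in l , <-≤-trans h z≤q)
        (λ w j supp → let l , h = w j supp in ≤-trans x≤p l , h)
        (λ w w′ j supp → proj₁ (w′ j supp) , proj₂ (w j supp)) (parts ν) ⟩
      #within s ν x q + #within s ν p z       ≤⟨ +-monoʳ-≤ _ (#within-≤ p≤z) ⟩
      #within s ν x q + (z ∸ p)               ∎))
    where open ≤-Reasoning

  -- A sweep from the left, starting with the empty interval: if `[x , z)` is tight and `z < y`, the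
  -- tight interval through `z` is merged into it, and its end becomes the new `z`. The number `n`
  -- bounds the remaining distance.
  tight-cover : ∀ {x y} → x ≤ y →
    (∀ j → x ≤ j → j < y → ∃₂ λ p q → x ≤ p × p ≤ j × j < q × q ≤ y × IsTight p q) → IsTight x y
  tight-cover {x} {y} x≤y cover = go y x ≤-refl x≤y (m≤n+m y x)
    (trans (n≤0⇒n≡0 (≤-trans (#within-≤ ≤-refl) (≤-reflexive (n∸n≡0 x)))) (sym (n∸n≡0 x)))
    where
    go : ∀ n z → x ≤ z → z ≤ y → y ≤ z + n → IsTight x z → IsTight x y
    go n z x≤z z≤y y≤z+n tight with m≤n⇒m<n∨m≡n z≤y
    ... | inj₂ refl = tight
    go zero    z x≤z z≤y y≤z+n tight | inj₁ z<y = contradiction z<y (≤⇒≯ (≤-trans y≤z+n (≤-reflexive (+-identityʳ z))))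
    go (suc n) z x≤z z≤y y≤z+n tight | inj₁ z<y =
      let p , q , x≤p , p≤z , z<q , q≤y , tight′ = cover z x≤z z<y
      in go n q (≤-trans x≤z (<⇒≤ z<q)) q≤y
           (≤-trans y≤z+n (≤-trans (≤-reflexive (+-suc z n)) (+-monoˡ-≤ n z<q)))
           (tight-union x≤p p≤z (<⇒≤ z<q) tight tight′)

  -- The bounds on `p` and `q` make this decidable and keep the intervals inside the range `[1 , N)`
  -- that `Cuts` divides.
  InTight : ℕ → Set
  InTight j = ∃ λ p → p < suc j × (1 ≤ p × (∃ λ q → q < suc N × (j < q × IsTight p q)))

  inTight? : Decidable InTight
  inTight? j = anyUpTo? (λ p → (1 ≤? p) ×-dec
    anyUpTo? (λ q → (j <? q) ×-dec (#within s ν p q ≟ q ∸ p)) (suc N)) (suc j)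

  HasRows : (ℕ → ℕ) → Set
  HasRows t = concat< (rows t) N ≡ parts ν

  mix-supp : ∀ {t j} → Mix t j → suc (pred (t j)) ≡ t j × Supp s (pred (t j)) j
  mix-supp {t} {j} (top<t , t<bot) = eq , bounds-supp (<-≤-trans top<t (≤-reflexive (sym eq))) (≤-<-trans (≤-reflexive eq) t<bot)
    where
    eq : suc (pred (t j)) ≡ t j
    eq = suc-pred (t j) ⦃ >-nonZero (≤-<-trans z≤n top<t) ⦄

  -- The support of the entry that column `j` contributes consists of the columns in which `t j`
  -- would again be the separator of a mixed column. Bounds on `t j` thus confine the support.
  supp-around : ∀ {t j y} → Mix t j → Supp s (pred (t j)) y → top y < t j × t j < bot y
  supp-around {t} {j} {y} m supp = let eq = proj₁ (mix-supp {t} m) ; top<i , i<bot = supp-bounds supp in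
    <-≤-trans top<i (≤-reflexive eq) , ≤-<-trans (≤-reflexive (sym eq)) i<bot

  module _ {Q : ℕ → Set} (Q? : Decidable Q) where

    #rows : (ℕ → ℕ) → ℕ → ℕ
    #rows t j = length (filter Q? (rows t j))

    #rows-≤1 : ∀ t j → #rows t j ≤ 1
    #rows-≤1 t j with mix? t j
    ... | yes _ = ≤-trans (length-filter Q? [ pred (t j) ]) ≤-refl
    ... | no  _ = z≤n

    #rows-1 : ∀ t {j} → Mix t j → Q (pred (t j)) → #rows t j ≡ 1
    #rows-1 t {j} m q = trans (cong (length ∘ filter Q?) (rows-mix {t} m)) (cong length (filter-accept Q? q))

    #rows-0 : ∀ t {j} → (Mix t j → ¬ Q (pred (t j))) → #rows t j ≡ 0
    #rows-0 t {j} ¬q with mix? t j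
    ... | yes m = cong length (filter-reject Q? (¬q m))
    ... | no  _ = refl

    #rows-cong : ∀ t u {j} → t j ≡ u j → #rows t j ≡ #rows u j
    #rows-cong t u eq = cong (length ∘ filter Q?) (rows-cong {t} {u} eq)

    -- Double counting: entries of `ν` are counted by the columns that contribute them, at most one
    -- each.
    #rows-total : ∀ {t} → HasRows t → sum< (#rows t) N ≡ length (filter Q? (parts ν))
    #rows-total {t} hasRows = trans (sym (length-filter-concat< Q? (rows t) N)) (cong (length ∘ filter Q?) hasRows)

  -- Pigeonhole: the b ∸ a entries of ν with support in [a , b) sit in distinct columns of [a , b).
  tight-mixed : ∀ {t} → HasRows t → ∀ {a b j} → IsTight a b → a ≤ j → j < b → Mix t j
  tight-mixed {t} hasRows {a} {b} {j} tight a≤j j<b = decidable-stable (mix? t j) λ ¬m → <-irrefl tight (begin-strict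
    #within s ν a b                                   ≡⟨ #rows-total within? hasRows ⟨
    sum< f N                                          ≤⟨ sum-N≤sum-b ⟩
    sum< f b                                          ≤⟨ sum<-≤1 f b j<b (#rows-≤1 within? t) ⟩
    sum< f j + f j + (b ∸ suc j)
      ≡⟨ cong (λ x → sum< f j + x + (b ∸ suc j)) (#rows-0 within? t λ m → contradiction m ¬m) ⟩
    sum< f j + 0 + (b ∸ suc j)                        ≡⟨ cong (_+ (b ∸ suc j)) (+-identityʳ (sum< f j)) ⟩
    sum< f j + (b ∸ suc j)                            ≤⟨ +-monoˡ-≤ (b ∸ suc j) (sum<-≤1 f j a≤j (#rows-≤1 within? t)) ⟩
    sum< f a + (j ∸ a) + (b ∸ suc j)
      ≡⟨ cong (λ x → x + (j ∸ a) + (b ∸ suc j)) (sum<-zero a λ i i<a → outside i (inj₁ i<a)) ⟩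
    (j ∸ a) + (b ∸ suc j)                             <⟨ +-monoʳ-< (j ∸ a) (∸-monoʳ-< ≤-refl j<b) ⟩
    (j ∸ a) + (b ∸ j)                                 ≡⟨ +-∸-comm (b ∸ j) a≤j ⟨
    j + (b ∸ j) ∸ a                                   ≡⟨ cong (_∸ a) (m+[n∸m]≡n (<⇒≤ j<b)) ⟩
    b ∸ a                                             ∎)
    where
    open ≤-Reasoning
    within? : Decidable (SuppWithin s a b)
    within? = suppWithin? s a b
    f : ℕ → ℕ
    f = #rows within? t
    outside : ∀ i → i < a ⊎ b ≤ i → f i ≡ 0
    outside i i∉ = #rows-0 within? t λ m within → excluded i∉ (within i (proj₂ (mix-supp {t} m)))
      where
      excluded : i < a ⊎ b ≤ i → ¬ (a ≤ i × i < b)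
      excluded (inj₁ i<a) (a≤i , _) = <⇒≱ i<a a≤i
      excluded (inj₂ b≤i) (_ , i<b) = <⇒≱ i<b b≤i
    sum-N≤sum-b : sum< f N ≤ sum< f b
    sum-N≤sum-b with ≤-total N b
    ... | inj₁ N≤b = sum<-monoʳ f N≤b
    ... | inj₂ b≤N = ≤-reflexive (sum<-flat f N b≤N λ i b≤i _ → outside i (inj₂ b≤i))

  inTight-mixed : ∀ {t} → HasRows t → ∀ {j} → InTight j → Mix t j
  inTight-mixed hasRows (p , p<1+j , _ , q , _ , j<q , tight) = tight-mixed hasRows tight (s≤s⁻¹ p<1+j) j<q

  -- Tables that agree left of `c` must contribute, from `c` on, equally many entries of any sort
  -- `Q`. A suitable `Q` turns a first difference at `c` into a contradiction.
  #rows-separating : ∀ {t u c} {Q : ℕ → Set} (Q? : Decidable Q) → HasRows t → HasRows u →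
    (∀ j → j < c → t j ≡ u j) → sum< (#rows Q? t) N ≡ sum< (#rows Q? u) N × sum< (#rows Q? t) c ≡ sum< (#rows Q? u) c
  #rows-separating {t} {u} {c} Q? rows-t rows-u agree =
    trans (#rows-total Q? rows-t) (sym (#rows-total Q? rows-u)) ,
    sum<-cong c λ j j<c → #rows-cong Q? t u (agree j j<c)

  -- By induction on the distance, bounded by `n`: a pure column strictly between gives a closer
  -- pair of the same sort, whichever kind it has. Without one, all columns of `[suc j , c)` are
  -- mixed and their entries are supported there, so this interval is tight.
  no-two-before-one : ∀ {t} → Valid t → Decreasing t → HasRows t → ∀ {j c} → j < c → Two t j → One t c →
    (∀ x → j ≤ x → x ≤ c → ¬ InTight x) → ∀ {A : Set} → A
  no-two-before-one {t} valid-t dec hasRows {j} {c} j<c two-j one-c ¬tight = go c j<c two-j one-c ¬tight (m≤n+m c j)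
    where
    go : ∀ n {j c} → j < c → Two t j → One t c → (∀ x → j ≤ x → x ≤ c → ¬ InTight x) → c ≤ j + n →
         ∀ {A : Set} → A
    go zero {j} j<c _ _ _ c≤j+0 = contradiction j<c (≤⇒≯ (≤-trans c≤j+0 (≤-reflexive (+-identityʳ j))))
    go (suc n) {j} {c} j<c (col-j , t≡top) (col-c , t≡bot) ¬tight c≤j+1+n with m≤n⇒m<n∨m≡n j<c
    -- Neighbours share a row, so `t j ≡ top j < bot c ≡ t c`, against weak decrease.
    ... | inj₂ refl = contradiction (dec j)
      (<⇒≱ (subst₂ _<_ (sym t≡top) (sym t≡bot) (neighbours-overlap connected col-j col-c)))
    ... | inj₁ 1+j<c = contradiction inTight (¬tight (suc j) (n≤1+n j) (<⇒≤ 1+j<c))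
      where
      mixed : ∀ x → j < x → x < c → Mix t x
      mixed x j<x x<c with kind valid-t (range-column noEmpty (≤-trans (s≤s z≤n) j<x)
                                                       (≤-trans (<⇒≤ x<c) (proj₂ (column-range col-c))))
      ... | isMix m = m
      ... | isOne o = go n j<x (col-j , t≡top) o (λ y j≤y y≤x → ¬tight y j≤y (≤-trans y≤x (<⇒≤ x<c)))
        (s≤s⁻¹ (≤-trans x<c (≤-trans c≤j+1+n (≤-reflexive (+-suc j n)))))
      ... | isTwo w = go n x<c w (col-c , t≡bot) (λ y x≤y → ¬tight y (≤-trans (<⇒≤ j<x) x≤y))
        (≤-trans c≤j+1+n (≤-trans (≤-reflexive (+-suc j n)) (+-monoˡ-≤ n j<x)))

      within? : Decidable (SuppWithin s (suc j) c)
      within? = suppWithin? s (suc j) c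

      -- Weak decrease gives `bot c ≤ t x ≤ top j`, so the support reaches neither column `j` nor
      -- column `c`.
      within : ∀ x → (m : Mix t x) → j < x → x < c → SuppWithin s (suc j) c (pred (t x))
      within x m j<x x<c y supp = let top<t , t<bot = supp-around {t} m supp in
        ≰⇒> (λ y≤j → <⇒≱ top<t
          (≤-trans (Decreasing-≤ dec (<⇒≤ j<x)) (≤-trans (≤-reflexive t≡top) (top-antitone y≤j)))) ,
        ≰⇒> (λ c≤y → <⇒≱ t<bot
          (≤-trans (bot-antitone c≤y) (≤-trans (≤-reflexive (sym t≡bot)) (Decreasing-≤ dec (<⇒≤ x<c)))))

      tight : IsTight (suc j) c
      tight = ≤-antisym (#within-≤ j<c) (begin
        c ∸ suc j                                                ≤⟨ m≤n+m _ _ ⟩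
        sum< (#rows within? t) (suc j) + (c ∸ suc j)             ≤⟨ sum<-≥1 (#rows within? t) c j<c (λ x j<x x<c →
          let m = mixed x j<x x<c in ≤-reflexive (sym (#rows-1 within? t m (within x m j<x x<c)))) ⟩
        sum< (#rows within? t) c                                 ≤⟨ sum<-monoʳ (#rows within? t) (<⇒≤ (column<N col-c)) ⟩
        sum< (#rows within? t) N                                 ≡⟨ #rows-total within? hasRows ⟩
        #within s ν (suc j) c                                    ∎)
        where open ≤-Reasoning

      inTight : InTight (suc j)
      inTight = suc j , ≤-refl , s≤s z≤n , c , m<n⇒m<1+n (column<N col-c) , 1+j<c , tight

  ones twos : (ℕ → ℕ) → ℕ → ℕ
  ones t = sum< (indicator ∘ one? t)
  twos t = sum< (indicator ∘ two? t)

  -- A stretch around `c` outside all tight intervals with equally many 1-pure columns in `t` and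
  -- `u`; `balanced` states this equality of two differences without subtraction.
  record Block (t u : ℕ → ℕ) (c : ℕ) : Set where
    field
      left right   : ℕ
      left≤        : left ≤ c
      <right       : c < right
      untight      : ∀ j → left ≤ j → j < right → ¬ InTight j
      balanced     : ones t right + ones u left ≡ ones u right + ones t left

  Blocks : (t u : ℕ → ℕ) → Set
  Blocks t u = ∀ c → Column c → ¬ InTight c → Block t u c

  one-cong : ∀ {t u j} → t j ≡ u j → indicator (one? t j) ≡ indicator (one? u j)
  one-cong {t} {u} {j} eq = indicator-⇔
    (mk⇔ (λ (col , e) → col , trans (sym eq) e) (λ (col , e) → col , trans eq e)) (one? t j) (one? u j)

  module _ {t u : ℕ → ℕ} (valid-t : Valid t) (valid-u : Valid u) (rows-t : HasRows t) (rows-u : HasRows u)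
           (dec-u : Decreasing u) (blocks : Blocks t u)
           {c : ℕ} (agree : ∀ j → j < c → t j ≡ u j) (col : Column c) (u<t : u c < t c) where

    -- Count the entries that are at least `pred (t c)`. Column `c` of `t` contributes one, whereas
    -- `u` has none from `c` on, since `u j ≤ u c < t c` there; the totals and the counts left of
    -- `c` agree.
    first-difference-mixed : ¬ Mix t c
    first-difference-mixed m = <-irrefl (proj₂ sums) (begin-strict
      sum< (#rows Q? t) c                ≡⟨ +-identityʳ _ ⟨
      sum< (#rows Q? t) c + 0
        <⟨ +-monoʳ-< _ (≤-reflexive (sym (#rows-1 Q? t m (≤-reflexive (sym (proj₁ (mix-supp {t} m))))))) ⟩
      sum< (#rows Q? t) (suc c)          ≤⟨ sum<-monoʳ (#rows Q? t) (column<N col) ⟩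
      sum< (#rows Q? t) N                ≡⟨ proj₁ sums ⟩
      sum< (#rows Q? u) N
        ≡⟨ sum<-flat (#rows Q? u) N (<⇒≤ (column<N col)) (λ j c≤j _ → #rows-0 Q? u λ m′ q →
        <⇒≱ u<t (≤-trans q (≤-trans (≤-reflexive (proj₁ (mix-supp {u} m′))) (Decreasing-≤ dec-u c≤j)))) ⟩
      sum< (#rows Q? u) c                ∎)
      where
      open ≤-Reasoning
      Q? : Decidable (λ i → t c ≤ suc i)
      Q? i = t c ≤? suc i
      sums = #rows-separating {t} {u} Q? rows-t rows-u agree

    -- The next 1-pure column c′ of u in the block of c exists by counting.  All columns of u in
    -- [c , c′) are mixed, and the supports of their rows lie left of c′, so in t these rows would
    -- have to fit into the columns strictly between c and c′.
    first-difference-one : ¬ One t c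
    first-difference-one o@(_ , t≡bot) with inTight? c
    ... | yes tight-c = one≢mix {t} o (inTight-mixed rows-t tight-c)
    ... | no ¬tight-c = <-irrefl (sym (proj₂ sums)) (+-cancelʳ-< (c′ ∸ suc c) _ _ (begin-strict
        sum< (#rows Q? u) c + (c′ ∸ suc c)                <⟨ +-monoʳ-< (sum< (#rows Q? u) c) (∸-monoʳ-< ≤-refl c<c′) ⟩
        sum< (#rows Q? u) c + (c′ ∸ c)                    ≤⟨ sum<-≥1 (#rows Q? u) c′ (<⇒≤ c<c′) (λ j c≤j j<c′ →
          ≤-reflexive (sym (#rows-1 Q? u (mixed j c≤j j<c′) (within j c≤j j<c′)))) ⟩
        sum< (#rows Q? u) c′                              ≤⟨ sum<-monoʳ (#rows Q? u) (<⇒≤ (column<N (proj₁ one-c′))) ⟩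
        sum< (#rows Q? u) N                               ≡⟨ proj₁ sums ⟨
        sum< (#rows Q? t) N
          ≡⟨ sum<-flat (#rows Q? t) N (<⇒≤ (column<N (proj₁ one-c′))) (λ j c′≤j _ →
          #rows-0 Q? t λ m q → <⇒≱ (proj₂ (q j (proj₂ (mix-supp {t} m)))) c′≤j) ⟩
        sum< (#rows Q? t) c′                              ≤⟨ sum<-≤1 (#rows Q? t) c′ c<c′ (#rows-≤1 Q? t) ⟩
        sum< (#rows Q? t) c + #rows Q? t c + (c′ ∸ suc c)
          ≡⟨ cong (λ x → sum< (#rows Q? t) c + x + (c′ ∸ suc c)) (#rows-0 Q? t λ m → contradiction m (one≢mix {t} o)) ⟩
        sum< (#rows Q? t) c + 0 + (c′ ∸ suc c)            ≡⟨ cong (_+ (c′ ∸ suc c)) (+-identityʳ _) ⟩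
        sum< (#rows Q? t) c + (c′ ∸ suc c)                ∎))
      where
      open ≤-Reasoning
      open Block (blocks c col ¬tight-c)
      c′ = first (one? u) c (right ∸ c)
      c+[right∸c]≡right = m+[n∸m]≡n (<⇒≤ <right)

      ones-agree : ∀ {n} → n ≤ c → ones t n ≡ ones u n
      ones-agree {n} n≤c = sum<-cong n λ j j<n → one-cong {t} {u} (agree j (<-≤-trans j<n n≤c))

      ones-right : ones t right ≡ ones u right
      ones-right = +-cancelʳ-≡ (ones u left) _ _ (trans balanced (cong (ones u right +_) (ones-agree left≤)))

      c′<right : c′ < right
      c′<right = ≰⇒> λ right≤c′ → <-irrefl (sym ones-right) (begin-strict
        ones u right              ≡⟨ sum<-flat (indicator ∘ one? u) right (<⇒≤ <right) (λ j c≤j j<right →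
          indicator-false (one? u j) (first-minimal (one? u) c (right ∸ c) j c≤j (<-≤-trans j<right right≤c′))) ⟩
        ones u c                  ≡⟨ ones-agree ≤-refl ⟨
        ones t c                  ≡⟨ +-identityʳ _ ⟨
        ones t c + 0              <⟨ +-monoʳ-< _ (≤-reflexive (sym (indicator-true (one? t c) o))) ⟩
        ones t (suc c)            ≤⟨ sum<-monoʳ (indicator ∘ one? t) <right ⟩
        ones t right              ∎)

      one-c′ : One u c′
      one-c′ = first-holds (one? u) c (right ∸ c) (<-≤-trans c′<right (≤-reflexive (sym c+[right∸c]≡right)))

      c<c′ : c < c′
      c<c′ = ≤∧≢⇒< (first-≥ (one? u) c (right ∸ c)) λ c≡c′ →
        <⇒≢ u<t (trans (proj₂ (subst (One u) (sym c≡c′) one-c′)) (sym t≡bot))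

      mixed : ∀ j → c ≤ j → j < c′ → Mix u j
      mixed j c≤j j<c′ = go (kind valid-u (range-column noEmpty (≤-trans (proj₁ (column-range col)) c≤j)
                                             (≤-trans (<⇒≤ j<c′) (proj₂ (column-range (proj₁ one-c′))))))
        where
        go : Kind u j → Mix u j
        go (isMix m)  = m
        go (isOne o′) = contradiction o′ (first-minimal (one? u) c (right ∸ c) j c≤j j<c′)
        go (isTwo w)  = no-two-before-one valid-u dec-u rows-u j<c′ w one-c′ λ x j≤x x≤c′ →
          untight x (≤-trans left≤ (≤-trans c≤j j≤x)) (≤-<-trans x≤c′ c′<right)

      Q? : Decidable (SuppWithin s 0 c′)
      Q? = suppWithin? s 0 c′

      sums = #rows-separating {t} {u} Q? rows-t rows-u agree

      within : ∀ j → c ≤ j → j < c′ → SuppWithin s 0 c′ (pred (u j))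
      within j c≤j j<c′ y supp = z≤n , ≰⇒> λ c′≤y →
        <⇒≱ (proj₂ (supp-around {u} (mixed j c≤j j<c′) supp))
            (≤-trans (bot-antitone c′≤y) (≤-trans (≤-reflexive (sym (proj₂ one-c′))) (Decreasing-≤ dec-u (<⇒≤ j<c′))))

    no-first-difference : ∀ {A : Set} → A
    no-first-difference with kind valid-t col
    ... | isOne o = contradiction o first-difference-one
    ... | isMix m = contradiction m first-difference-mixed
    ... | isTwo (_ , t≡top) = contradiction u<t (≤⇒≯ (≤-trans (≤-reflexive t≡top) (proj₁ (valid-u c))))

  -- At the first difference either table may have the larger separator; blocks are symmetric, so
  -- the previous lemma serves both cases. In an empty column validity forces equality.
  decreasing-unique : ∀ {t u} → Valid t → Valid u → HasRows t → HasRows u → Decreasing t → Decreasing u →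
    Blocks t u → ∀ j → t j ≡ u j
  decreasing-unique {t} {u} valid-t valid-u rows-t rows-u dec-t dec-u blocks j = agree (suc j) j ≤-refl
    where
    blocks′ : Blocks u t
    blocks′ c col ¬tight = let open Block (blocks c col ¬tight) in record
      { left = left ; right = right ; left≤ = left≤ ; <right = <right ; untight = untight ; balanced = sym balanced }
    agree : ∀ n j → j < n → t j ≡ u j
    agree (suc n) j j<1+n with m≤n⇒m<n∨m≡n (s≤s⁻¹ j<1+n)
    ... | inj₁ j<n = agree n j j<n
    ... | inj₂ refl with top j <? bot j
    ...   | no ¬col = ≤-antisym (≤-trans (proj₂ (valid-t j)) (≤-trans (≮⇒≥ ¬col) (proj₁ (valid-u j))))
                                (≤-trans (proj₂ (valid-u j)) (≤-trans (≮⇒≥ ¬col) (proj₁ (valid-t j))))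
    ...   | yes col with <-cmp (t j) (u j)
    ...     | tri< t<u _ _ = no-first-difference valid-u valid-t rows-u rows-t dec-t blocks′ (λ i i<j → sym (agree j i i<j)) col t<u
    ...     | tri≈ _ t≡u _ = t≡u
    ...     | tri> _ _ u<t = no-first-difference valid-t valid-u rows-t rows-u dec-u blocks (agree j) col u<t

-- Invariants of resolution, and the effect of flipping

module Invariants (s : SkewPartition) (connected : Connected s) (noEmpty : NoEmptyColumns s)
                  (ν : Partition) (representable : Representable s ν) where

  open Columns s
  open Separators s
  open Resolution s
  open Counting s connected noEmpty ν representable
  open Represents
  open Step
  open Equivalence

  private
    N : ℕ
    N = suc (width s)

  two-cong : ∀ {t u j} → t j ≡ u j → indicator (two? t j) ≡ indicator (two? u j)
  two-cong {t} {u} {j} eq = indicator-⇔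
    (mk⇔ (λ (col , e) → col , trans (sym eq) e) (λ (col , e) → col , trans eq e)) (two? t j) (two? u j)

  -- A pure column contributes the empty list, so letting a separator pass it does not change the
  -- concatenation.
  step-rows : ∀ {k t u} → Step k t u → concat< (rows u) N ≡ concat< (rows t) N
  step-rows {k} {t} {u} step =
    Concat.prefix-swap k (λ j j≢k j≢1+k → rows-cong {u} {t} (unmoved step j j≢k j≢1+k)) (swapped (moved step)) N
      (<⇒≢ (column<N (proj₂ (step-column step))) ∘ sym)
    where
    swapped : Moved k t u → rows u k ++ rows u (suc k) ≡ rows t k ++ rows t (suc k)
    swapped (mixed-pure1 m o o′ m′ eq) = begin
      rows u k ++ rows u (suc k)     ≡⟨ cong₂ _++_ (rows-¬mix {u} (one≢mix {u} o′)) (rows-mix {u} m′) ⟩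
      [ pred (u (suc k)) ]           ≡⟨ cong (λ x → [ pred x ]) eq ⟩
      [ pred (t k) ]                 ≡⟨ cong₂ _++_ (rows-mix {t} m) (rows-¬mix {t} (one≢mix {t} o)) ⟨
      rows t k ++ rows t (suc k)     ∎
      where open ≡-Reasoning
    swapped (pure2-mixed w m m′ w′ eq) = begin
      rows u k ++ rows u (suc k)     ≡⟨ cong₂ _++_ (rows-mix {u} m′) (rows-¬mix {u} (two≢mix {u} w′)) ⟩
      [ pred (u k) ]                 ≡⟨ cong (λ x → [ pred x ]) eq ⟩
      [ pred (t (suc k)) ]           ≡⟨ cong₂ _++_ (rows-¬mix {t} (two≢mix {t} w)) (rows-mix {t} m) ⟨
      rows t k ++ rows t (suc k)     ∎
      where open ≡-Reasoning
    swapped (pure2-pure1 w o o′ w′) = trans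
      (cong₂ _++_ (rows-¬mix {u} (one≢mix {u} o′)) (rows-¬mix {u} (two≢mix {u} w′)))
      (sym (cong₂ _++_ (rows-¬mix {t} (two≢mix {t} w)) (rows-¬mix {t} (one≢mix {t} o))))

  module _ (t : ℕ → ℕ) (j : ℕ) where

    one-count two-count : ℕ
    one-count = indicator (one? t j)
    two-count = indicator (two? t j)

    counts-one : One t j → one-count ≡ 1 × two-count ≡ 0
    counts-one o = indicator-true (one? t j) o , indicator-false (two? t j) (one≢two {t} o)

    counts-two : Two t j → one-count ≡ 0 × two-count ≡ 1
    counts-two w = indicator-false (one? t j) (λ o → one≢two {t} o w) , indicator-true (two? t j) w

    counts-mix : Mix t j → one-count ≡ 0 × two-count ≡ 0
    counts-mix m = indicator-false (one? t j) (λ o → one≢mix {t} o m) , indicator-false (two? t j) (λ w → two≢mix {t} w m)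

  step-counts : ∀ {k t u} → Step k t u → ∀ n → n ≢ suc k → ones u n ≡ ones t n × twos u n ≡ twos t n
  step-counts {k} {t} {u} step n n≢1+k =
    sum<-swap k (λ j j≢k j≢1+k → one-cong {u} {t} (unmoved step j j≢k j≢1+k)) (proj₁ (swapped (moved step))) n n≢1+k ,
    sum<-swap k (λ j j≢k j≢1+k → two-cong {u} {t} (unmoved step j j≢k j≢1+k)) (proj₂ (swapped (moved step))) n n≢1+k
    where
    exchange : ∀ {a b c d} → a ≡ d → b ≡ c → a + b ≡ c + d
    exchange {a} {b} refl refl = +-comm a b
    exchange₂ : ∀ {a a′ b b′ c c′ d d′} → a ≡ d × a′ ≡ d′ → b ≡ c × b′ ≡ c′ →
                a + b ≡ c + d × a′ + b′ ≡ c′ + d′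
    exchange₂ (p , p′) (q , q′) = exchange p q , exchange p′ q′
    sym₂ : ∀ {a b a′ b′ c c′ : ℕ} → a ≡ c × a′ ≡ c′ → b ≡ c × b′ ≡ c′ → a ≡ b × a′ ≡ b′
    sym₂ (p , p′) (q , q′) = trans p (sym q) , trans p′ (sym q′)
    swapped : Moved k t u →
      one-count u k + one-count u (suc k) ≡ one-count t k + one-count t (suc k) ×
      two-count u k + two-count u (suc k) ≡ two-count t k + two-count t (suc k)
    swapped (mixed-pure1 m o o′ m′ _) = exchange₂
      (sym₂ (counts-one u k o′) (counts-one t (suc k) o)) (sym₂ (counts-mix u (suc k) m′) (counts-mix t k m))
    swapped (pure2-mixed w m m′ w′ _) = exchange₂
      (sym₂ (counts-mix u k m′) (counts-mix t (suc k) m)) (sym₂ (counts-two u (suc k) w′) (counts-two t k w))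
    swapped (pure2-pure1 w o o′ w′) = exchange₂
      (sym₂ (counts-one u k o′) (counts-one t (suc k) o)) (sym₂ (counts-two u (suc k) w′) (counts-two t k w))

  -- A column in a tight interval is mixed both in `t` and in `u`, but each of the two columns of a
  -- resolution is pure before or after it.
  step-untight : ∀ {k t u} → Step k t u → HasRows t → HasRows u → ¬ (InTight k ⊎ InTight (suc k))
  step-untight {k} {t} {u} step rows-t rows-u (inj₁ tight)
    with inTight-mixed {t} rows-t tight | inTight-mixed {u} rows-u tight | moved step
  ... | _ | m | mixed-pure1 _ _ o _ _ = one≢mix {u} o m
  ... | m | _ | pure2-mixed w _ _ _ _ = two≢mix {t} w m
  ... | m | _ | pure2-pure1 w _ _ _   = two≢mix {t} w m
  step-untight {k} {t} {u} step rows-t rows-u (inj₂ tight)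
    with inTight-mixed {t} rows-t tight | inTight-mixed {u} rows-u tight | moved step
  ... | m | _ | mixed-pure1 _ o _ _ _ = one≢mix {t} o m
  ... | _ | m | pure2-mixed _ _ _ w _ = two≢mix {u} w m
  ... | m | _ | pure2-pure1 _ o _ _   = one≢mix {t} o m

  -- No resolution moves a 1-pure or 2-pure column across a boundary.
  Boundary : ℕ → Set
  Boundary n = ∀ k → suc k ≡ n → Column k → Column n → InTight k ⊎ InTight n

  SameCounts : (t u : ℕ → ℕ) → Set
  SameCounts t u = ∀ n → Boundary n → ones u n ≡ ones t n × twos u n ≡ twos t n

  path-invariants : ∀ {t u P Q} → Represents t P → Represents u Q → Star _↝_ P Q → HasRows t →
                    HasRows u × SameCounts t u
  path-invariants {t} {u} repP repQ nil rows-t =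
    trans (Concat.prefix-cong N λ j _ → rows-cong {u} {t} (u≗t j)) rows-t ,
    λ n _ → sum<-cong n (λ j _ → one-cong {u} {t} (u≗t j)) , sum<-cong n (λ j _ → two-cong {u} {t} (u≗t j))
    where
    u≗t : ∀ j → u j ≡ t j
    u≗t j = separators-unique repQ repP j λ _ _ → refl
  path-invariants {t} {u} repP repQ (_◅_ {j = R} (k , resolves) path) rows-t =
    rows-u , λ n boundary → let o , w = first-step n boundary ; o′ , w′ = rest n boundary in trans o′ o , trans w′ w
    where
    r : ℕ → ℕ
    r = separators R
    step : Step k t r
    step = resolves→step repP (separators-represent R) resolves
    rows-r : HasRows r
    rows-r = trans (step-rows step) rows-t
    induction : HasRows u × SameCounts r u
    induction = path-invariants (separators-represent R) repQ path rows-r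
    rows-u : HasRows u
    rows-u = proj₁ induction
    rest : SameCounts r u
    rest = proj₂ induction
    first-step : SameCounts t r
    -- A resolution at `k` can change only the prefix of length `suc k`; were that a boundary, one
    -- of the two columns would lie in a tight interval.
    first-step n boundary = step-counts step n λ { refl →
      step-untight step rows-t rows-r (boundary k refl (proj₁ (step-column step)) (proj₂ (step-column step))) }

  flip-counts : ∀ t n → ones (flipSeparators t) n ≡ twos t n × twos (flipSeparators t) n ≡ ones t n
  flip-counts t n =
    sum<-cong n (λ j _ → indicator-⇔ (flip-one {t}) (one? (flipSeparators t) j) (two? t j)) ,
    sum<-cong n (λ j _ → indicator-⇔ (flip-two {t}) (two? (flipSeparators t) j) (one? t j))

  flip-rows : ∀ {t} → HasRows t → HasRows (flipSeparators t)
  flip-rows {t} rows-t = trans (Concat.prefix-cong N λ j _ → rows-flip t j) rows-t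

  flip-sepsDecrease : ∀ {t} → Decreasing t → SepsDecrease (flipSeparators t)
  flip-sepsDecrease {t} dec k<l mₖ mₗ =
    subst₂ _≤_ (sym (proj₂ (flip-mix {t} mₗ))) (sym (proj₂ (flip-mix {t} mₖ))) (Decreasing-≤ dec (<⇒≤ k<l))

  #pure-one : ∀ {t T} → Represents t T → ∀ {a b} → a ≤ b → ones t a + #pure one T a b ≡ ones t b
  #pure-one {t} {T} rep {a} {b} a≤b = begin
    ones t a + #pure one T a b                               ≡⟨ cong (_+ #pure one T a b) (convert a) ⟨
    sum< (indicator ∘ pure? one T) a + #pure one T a b       ≡⟨ length-filter-interval (pure? one T) a≤b ⟩
    sum< (indicator ∘ pure? one T) b                         ≡⟨ convert b ⟩
    ones t b                                                 ∎
    where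
    open ≡-Reasoning
    convert : ∀ n → sum< (indicator ∘ pure? one T) n ≡ ones t n
    convert n = sum<-cong n λ j _ → indicator-⇔ (pure-one rep) (pure? one T j) (one? t j)

  #pure-two : ∀ {t T} → Represents t T → ∀ {a b} → a ≤ b → twos t a + #pure two T a b ≡ twos t b
  #pure-two {t} {T} rep {a} {b} a≤b = begin
    twos t a + #pure two T a b                               ≡⟨ cong (_+ #pure two T a b) (convert a) ⟨
    sum< (indicator ∘ pure? two T) a + #pure two T a b       ≡⟨ length-filter-interval (pure? two T) a≤b ⟩
    sum< (indicator ∘ pure? two T) b                         ≡⟨ convert b ⟩
    twos t b                                                 ∎
    where
    open ≡-Reasoning
    convert : ∀ n → sum< (indicator ∘ pure? two T) n ≡ twos t n
    convert n = sum<-cong n λ j _ → indicator-⇔ (pure-two rep) (pure? two T j) (two? t j)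

-- Cuts, runs of tight intervals and components

module Components (s : SkewPartition) (connected : Connected s) (noEmpty : NoEmptyColumns s)
                  (ν : Partition) (representable : Representable s ν) where

  open Columns s
  open Separators s
  open Resolution s
  open Counting s connected noEmpty ν representable
  open Invariants s connected noEmpty ν representable
  open Represents

  private
    N : ℕ
    N = suc (width s)

  module CutBounds (d : Cuts s) where

    open Cuts d

    b≤a : ∀ k → k ≤ r → b k ≤ a (suc k)
    b≤a zero    _   = b₀≤a₁
    b≤a (suc k) k<r with m≤n⇒m<n∨m≡n k<r
    ... | inj₁ 1+k<r = <⇒≤ (b<a (suc k) (s≤s z≤n) 1+k<r)
    ... | inj₂ refl  = bᵣ≤a

    1≤b : ∀ k → k ≤ r → 1 ≤ b k
    1≤b zero    _   = ≤-reflexive (sym start)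
    1≤b (suc k) k<r = ≤-<-trans z≤n (a<b (suc k) (s≤s z≤n) k<r)

    a≤N : ∀ k → k ≤ r → a (suc k) ≤ N
    a≤N k k≤r = go (r ∸ k) k (m+[n∸m]≡n k≤r)
      where
      go : ∀ n k → k + n ≡ r → a (suc k) ≤ N
      go zero    k k+0≡r = ≤-reflexive (trans (cong (a ∘ suc) (trans (sym (+-identityʳ k)) k+0≡r)) end)
      go (suc n) k k+1+n≡r = ≤-trans (<⇒≤ (a<b (suc k) (s≤s z≤n) 1+k≤r))
        (≤-trans (b≤a (suc k) 1+k≤r) (go n (suc k) 1+k+n≡r))
        where
        1+k+n≡r : suc k + n ≡ r
        1+k+n≡r = trans (sym (+-suc k n)) k+1+n≡r
        1+k≤r : suc k ≤ r
        1+k≤r = ≤-trans (m≤m+n (suc k) n) (≤-reflexive 1+k+n≡r)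

    b≤N : ∀ k → k ≤ r → b k ≤ N
    b≤N k k≤r = ≤-trans (b≤a k k≤r) (a≤N k k≤r)

    covered-range : ∀ {j} → Covered d j → 1 ≤ j × j < N
    covered-range (k , k≤r , b≤j , j<a) = ≤-trans (1≤b k k≤r) b≤j , <-≤-trans j<a (a≤N k k≤r)

    module _ (tight : Tight ν d) where

      between-inTight : ∀ {k j} → k < r → a (suc k) ≤ j → j < b (suc k) → InTight j
      between-inTight {k} k<r a≤j j<b = a (suc k) , s≤s a≤j , ≤-trans (1≤b k (<⇒≤ k<r)) (b≤a k (<⇒≤ k<r)) ,
        b (suc k) , s≤s (b≤N (suc k) k<r) , j<b , tight (suc k) (s≤s z≤n) k<r

      -- The columns that the cuts do not cover form the intervals `[a k , b k)`, which are tight.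
      -- After `k` rounds, `j` is either already covered or not left of `b k`.
      untight-covered : ∀ {j} → 1 ≤ j → j < N → ¬ InTight j → Covered d j
      untight-covered {j} 1≤j j<N ¬tight with go r ≤-refl
        where
        go : ∀ k → k ≤ r → b k ≤ j ⊎ Covered d j
        go zero    _   = inj₁ (≤-trans (≤-reflexive start) 1≤j)
        go (suc k) k<r with go k (<⇒≤ k<r) | j <? a (suc k) | j <? b (suc k)
        ... | inj₂ covered | _       | _       = inj₂ covered
        ... | inj₁ b≤j     | yes j<a | _       = inj₂ (k , <⇒≤ k<r , b≤j , j<a)
        ... | inj₁ _       | no  j≮a | yes j<b = contradiction (between-inTight k<r (≮⇒≥ j≮a) j<b) ¬tight
        ... | inj₁ _       | no  _   | no  j≮b = inj₁ (≮⇒≥ j≮b)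
      ... | inj₂ covered = covered
      ... | inj₁ b≤j     = r , ≤-refl , b≤j , <-≤-trans j<N (≤-reflexive (sym end))

      -- The column just left of `b k` belongs to the tight interval `[a k , b k)`; for `k ≡ 0` it
      -- would be column 0, which is empty.
      b-boundary : ∀ k → k ≤ r → Boundary (b k)
      b-boundary zero    _   j eq col _ =
        contradiction (proj₁ (column-range col)) (<⇒≱ (≤-reflexive (trans eq start)))
      b-boundary (suc k) k<r j eq _ _ = inj₁ (between-inTight k<r
        (s≤s⁻¹ (<-≤-trans (a<b (suc k) (s≤s z≤n) k<r) (≤-reflexive (sym eq)))) (≤-reflexive eq))

      -- Here it is the column `a (suc k)` itself that begins a tight interval, and the last cut
      -- lies beyond all columns.
      a-boundary : ∀ k → k ≤ r → Boundary (a (suc k))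
      a-boundary k k≤r j _ _ col with m≤n⇒m<n∨m≡n k≤r
      ... | inj₁ k<r  = inj₂ (between-inTight k<r ≤-refl (a<b (suc k) (s≤s z≤n) k<r))
      ... | inj₂ refl = contradiction (column<N col) (≤⇒≯ (≤-reflexive (sym end)))

  module Next {P : ℕ → Set} (P? : Decidable P) where

    abstract

      -- The default is `N`, one past the last column, so a failing search also ends a run or a gap
      -- properly.
      next : ℕ → ℕ
      next x = first P? x (N ∸ x)

      next-≥ : ∀ x → x ≤ next x
      next-≥ x = first-≥ P? x (N ∸ x)

      next-≤ : ∀ {x} → x ≤ N → next x ≤ N
      next-≤ {x} x≤N = ≤-trans (first-≤ P? x (N ∸ x)) (≤-reflexive (m+[n∸m]≡n x≤N))

      next-holds : ∀ {x} → x ≤ N → next x < N → P (next x)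
      next-holds {x} x≤N lt = first-holds P? x (N ∸ x) (<-≤-trans lt (≤-reflexive (sym (m+[n∸m]≡n x≤N))))

      next-minimal : ∀ {x i} → x ≤ i → i < next x → ¬ P i
      next-minimal {x} = first-minimal P? x (N ∸ x) _

  module In  = Next inTight?
  module Out = Next (¬? ∘ inTight?)

  -- The intervals [runStart (suc k) , runEnd (suc k)) are the maximal runs of columns lying in
  -- tight intervals.
  runStart runEnd : ℕ → ℕ
  runStart zero    = 0
  runStart (suc k) = In.next (runEnd k)
  runEnd zero    = 1
  runEnd (suc k) = Out.next (runStart (suc k))

  runStart≤N : ∀ k → runStart k ≤ N
  runEnd≤N   : ∀ k → runEnd k ≤ N
  runStart≤N zero    = z≤n
  runStart≤N (suc k) = In.next-≤ (runEnd≤N k)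
  runEnd≤N zero    = s≤s z≤n
  runEnd≤N (suc k) = Out.next-≤ (runStart≤N (suc k))

  runStart<runEnd : ∀ k → runStart (suc k) < N → runStart (suc k) < runEnd (suc k)
  runStart<runEnd k lt = ≤∧≢⇒< (Out.next-≥ _) λ eq →
    Out.next-holds (runStart≤N (suc k)) (subst (_< N) eq lt) (subst InTight eq (In.next-holds (runEnd≤N k) lt))

  -- Equality would put one column both inside and outside the tight intervals. The index starts at
  -- `suc k`, because `runEnd 0` is 1 and column 1 may already lie in a tight interval; accordingly
  -- `b₀≤a₁` is weak.
  runEnd<runStart : ∀ k → runStart (suc (suc k)) < N → runEnd (suc k) < runStart (suc (suc k))
  runEnd<runStart k lt = ≤∧≢⇒< (In.next-≥ _) λ eq →
    Out.next-holds (runStart≤N (suc k)) (subst (_< N) (sym eq) lt) (subst InTight (sym eq) (In.next-holds (runEnd≤N (suc k)) lt))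

  -- Every run is nonempty, so there are fewer than `N` of them; this justifies the bound in the
  -- search for `runs`.
  runEnd-grows : ∀ n → (∀ m → m < n → runStart (suc m) < N) → suc n ≤ runEnd n
  runEnd-grows zero    _  = ≤-refl
  runEnd-grows (suc n) lt = begin-strict
    suc n                ≤⟨ runEnd-grows n (λ m m<n → lt m (m<n⇒m<1+n m<n)) ⟩
    runEnd n             ≤⟨ In.next-≥ _ ⟩
    runStart (suc n)     <⟨ runStart<runEnd n (lt n ≤-refl) ⟩
    runEnd (suc n)       ∎
    where open ≤-Reasoning

  abstract

    runs : ℕ
    runs = first (λ m → runStart (suc m) ≟ N) 0 N

    runStart<N : ∀ m → m < runs → runStart (suc m) < N
    runStart<N m m<runs = ≤∧≢⇒< (runStart≤N (suc m)) (first-minimal (λ m → runStart (suc m) ≟ N) 0 N m z≤n m<runs)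

    runStart-last : runStart (suc runs) ≡ N
    runStart-last = go (m≤n⇒m<n∨m≡n (first-≤ (λ m → runStart (suc m) ≟ N) 0 N))
      where
      go : runs < N ⊎ runs ≡ N → runStart (suc runs) ≡ N
      go (inj₁ lt) = first-holds (λ m → runStart (suc m) ≟ N) 0 N lt
      go (inj₂ eq) = contradiction (runEnd-grows N λ m m<N → runStart<N m (<-≤-trans m<N (≤-reflexive (sym eq))))
                                   (≤⇒≯ (runEnd≤N N))

  canonicalCuts : Cuts s
  canonicalCuts = record
    { r     = runs
    ; a     = runStart
    ; b     = runEnd
    ; start = refl
    ; end   = runStart-last
    ; b₀≤a₁ = In.next-≥ 1
    ; a<b   = λ { (suc k) _ k<r → runStart<runEnd k (runStart<N k k<r) }
    ; b<a   = λ { (suc k) _ k<r → runEnd<runStart k (runStart<N (suc k) k<r) }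
    ; bᵣ≤a  = In.next-≥ _
    }

  -- If a gap precedes the run, `i` is its last column and lies outside the tight intervals. There
  -- is always a gap, except possibly before the first run, which then starts at column 1 and leaves
  -- only `i ≡ 0`.
  run-maximal : ∀ k → runStart (suc k) < N → ∀ i → suc i ≡ runStart (suc k) → 1 ≤ i → ¬ InTight i
  run-maximal k lt i eq 1≤i = [ after-gap , no-gap k lt eq ]′ (m≤n⇒m<n∨m≡n (In.next-≥ (runEnd k)))
    where
    after-gap : runEnd k < runStart (suc k) → ¬ InTight i
    after-gap end<start = In.next-minimal (s≤s⁻¹ (<-≤-trans end<start (≤-reflexive (sym eq)))) (≤-reflexive eq)
    no-gap : ∀ k → runStart (suc k) < N → suc i ≡ runStart (suc k) → runEnd k ≡ runStart (suc k) → ¬ InTight i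
    no-gap zero    _  eq end≡start = contradiction (trans eq (sym end≡start)) (<⇒≢ (s≤s 1≤i) ∘ sym)
    no-gap (suc k) lt _  end≡start = contradiction end≡start (<⇒≢ (runEnd<runStart k lt))

  -- Each column of a run lies in a tight interval. That interval cannot stick out, or it would
  -- contain the column before the run or the one after it, which lie in no tight interval. Gluing
  -- these intervals gives the whole run.
  canonicalCuts-tight : Tight ν canonicalCuts
  canonicalCuts-tight (suc k) _ k<r = tight-cover (<⇒≤ (runStart<runEnd k start<N)) cover
    where
    start<N : runStart (suc k) < N
    start<N = runStart<N k k<r
    cover : ∀ j → runStart (suc k) ≤ j → j < runEnd (suc k) →
            ∃₂ λ p q → runStart (suc k) ≤ p × p ≤ j × j < q × q ≤ runEnd (suc k) × IsTight p q
    cover j start≤j j<end = inside (decidable-stable (inTight? j) (Out.next-minimal start≤j j<end))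
      where
      inside : InTight j → ∃₂ λ p q → runStart (suc k) ≤ p × p ≤ j × j < q × q ≤ runEnd (suc k) × IsTight p q
      inside (p , p<1+j , 1≤p , q , q<1+N , j<q , tight) =
        p , q , ≮⇒≥ ¬p<start , s≤s⁻¹ p<1+j , j<q , ≮⇒≥ ¬end<q , tight
        where
        ¬p<start : ¬ p < runStart (suc k)
        ¬p<start p<start = before (runStart (suc k)) refl p<start
          where
          before : ∀ x → x ≡ runStart (suc k) → ¬ p < x
          before (suc i) eq p<1+i = run-maximal k start<N i eq (≤-trans 1≤p (s≤s⁻¹ p<1+i))
            (p , p<1+i , 1≤p , q , q<1+N , <-trans (≤-trans (≤-reflexive eq) start≤j) j<q , tight)
        ¬end<q : ¬ runEnd (suc k) < q
        ¬end<q end<q = Out.next-holds (runStart≤N (suc k)) (<-≤-trans end<q (s≤s⁻¹ q<1+N))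
          (p , s≤s (≤-trans (s≤s⁻¹ p<1+j) (<⇒≤ j<end)) , 1≤p , q , q<1+N , end<q , tight)

  canonical-untight : ∀ {j} → Covered canonicalCuts j → ¬ InTight j
  canonical-untight (k , _ , b≤j , j<a) = In.next-minimal b≤j j<a

  -- This is more than minimality: the canonical union is least among those of all tight cuts.
  canonicalCuts-minimal : ∀ d → Tight ν d → ∀ {j} → Covered canonicalCuts j → Covered d j
  canonicalCuts-minimal d tight covered =
    let 1≤j , j<N = CutBounds.covered-range canonicalCuts covered
    in CutBounds.untight-covered d tight 1≤j j<N (canonical-untight covered)

  canonicalCuts-components : CutsIntoComponents ν canonicalCuts
  canonicalCuts-components = canonicalCuts-tight , λ d tight _ → canonicalCuts-minimal d tight

  -- The canonical cuts compete with `d` and cover no more, so by minimality `d` covers the same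
  -- columns.
  components-untight : ∀ d → CutsIntoComponents ν d → ∀ {j} → Covered d j → ¬ InTight j
  components-untight d (tight , minimal) covered =
    canonical-untight (minimal canonicalCuts canonicalCuts-tight (canonicalCuts-minimal d tight) covered)

-- The Bender-Knuth map and its characterisation

module BenderKnuth (s : SkewPartition) (connected : Connected s) (noEmpty : NoEmptyColumns s)
                   (ν : Partition) (representable : Representable s ν) where

  open Columns s
  open Separators s
  open Resolution s
  open Counting s connected noEmpty ν representable
  open Invariants s connected noEmpty ν representable
  open Components s connected noEmpty ν representable
  open Represents

  seps : RPP¹² s ν → ℕ → ℕ
  seps T = separators (table T)

  represents : ∀ (T : RPP¹² s ν) → Represents (seps T) (table T)
  represents T = separators-represent (table T)

  seps-rows : ∀ (T : RPP¹² s ν) → HasRows (seps T)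
  seps-rows T = trans (sym (seplist-rows (represents T))) (seplist≡ν T)

  seps-decreasing : ∀ (T : RPP¹² s ν) → Decreasing (seps T)
  seps-decreasing T = isRpp→decreasing (represents T) (isRpp T)

  #pure-≈ : ∀ {T U : Table s} → T ≈ᵗ U → ∀ {a b} → a ≤ b →
            #pure one T a b ≡ #pure one U a b × #pure two T a b ≡ #pure two U a b
  #pure-≈ {T} {U} T≈U {a} {b} a≤b =
    +-cancelˡ-≡ (ones t a) _ _ (trans (#pure-one repT a≤b) (sym (#pure-one repU a≤b))) ,
    +-cancelˡ-≡ (twos t a) _ _ (trans (#pure-two repT a≤b) (sym (#pure-two repU a≤b)))
    where
    t : ℕ → ℕ
    t = separators T
    repT : Represents t T
    repT = separators-represent T
    repU : Represents t U
    repU = ≈-represents T≈U repT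

  norm-invariants : ∀ (T : RPP¹² s ν) {u Q} → Represents u Q → Star _↝_ (flip (table T)) Q →
    HasRows u × (∀ n → Boundary n → ones u n ≡ twos (seps T) n × twos u n ≡ ones (seps T) n)
  norm-invariants T repQ path =
    let rows-u , counts = path-invariants (flip-represents (represents T)) repQ path (flip-rows (seps-rows T))
    in rows-u , λ n boundary →
         let o , w = counts n boundary ; o′ , w′ = flip-counts (seps T) n in trans o o′ , trans w w′

  abstract

    normal-form : ∀ (T : RPP¹² s ν) → Σ (RPP¹² s ν) λ U → Norm (flip (table T)) (table U)
    normal-form T =
      let u , U , repU , dec , path =
            normalise (flip-represents (represents T)) (flip-sepsDecrease {seps T} (seps-decreasing T))
          rpp = decreasing→isRpp repU dec
      in record { table = U ; isRpp = rpp ; seplist≡ν = trans (seplist-rows repU) (proj₁ (norm-invariants T repU path)) } ,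
         rpp , U , path , λ _ _ _ → refl

  image : RPP¹² s ν → RPP¹² s ν
  image T = proj₁ (normal-form T)

  image-norm : ∀ (T : RPP¹² s ν) → Norm (flip (table T)) (table (image T))
  image-norm T = proj₂ (normal-form T)

  -- Resolutions keep the seplist, so an arbitrary normal form `Q` becomes comparable with `image T`
  -- among the 12-rpps with seplist `ν`.
  norm-RPP : ∀ (T : RPP¹² s ν) {Q} → Norm (flip (table T)) Q → RPP¹² s ν
  norm-RPP T {Q} (rpp , P , path , P≈Q) = record
    { table     = Q
    ; isRpp     = rpp
    ; seplist≡ν = trans (seplist-rows repQ) (proj₁ (norm-invariants T (separators-represent P) path))
    }
    where
    repQ : Represents (separators P) Q
    repQ = ≈-represents P≈Q (separators-represent P)

  module WithCuts (d : Cuts s) (components : CutsIntoComponents ν d) where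

    open Cuts d
    open CutBounds d

    private
      tight : Tight ν d
      tight = proj₁ components

    norm-interchanges : ∀ (T : RPP¹² s ν) {Q} → Norm (flip (table T)) Q → ∀ k → k ≤ r →
      #pure one Q (b k) (a (suc k)) ≡ #pure two (table T) (b k) (a (suc k)) ×
      #pure two Q (b k) (a (suc k)) ≡ #pure one (table T) (b k) (a (suc k))
    norm-interchanges T {Q} (_ , P , path , P≈Q) k k≤r =
      +-cancelˡ-≡ (twos t (b k)) _ _ (begin
        twos t (b k) + #pure one Q (b k) (a (suc k))             ≡⟨ cong (_+ _) (proj₁ (counts _ b-ok)) ⟨
        ones q (b k) + #pure one Q (b k) (a (suc k))             ≡⟨ #pure-one repQ (b≤a k k≤r) ⟩
        ones q (a (suc k))                                       ≡⟨ proj₁ (counts _ a-ok) ⟩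
        twos t (a (suc k))                                       ≡⟨ #pure-two (represents T) (b≤a k k≤r) ⟨
        twos t (b k) + #pure two (table T) (b k) (a (suc k))     ∎) ,
      +-cancelˡ-≡ (ones t (b k)) _ _ (begin
        ones t (b k) + #pure two Q (b k) (a (suc k))             ≡⟨ cong (_+ _) (proj₂ (counts _ b-ok)) ⟨
        twos q (b k) + #pure two Q (b k) (a (suc k))             ≡⟨ #pure-two repQ (b≤a k k≤r) ⟩
        twos q (a (suc k))                                       ≡⟨ proj₂ (counts _ a-ok) ⟩
        ones t (a (suc k))                                       ≡⟨ #pure-one (represents T) (b≤a k k≤r) ⟨
        ones t (b k) + #pure one (table T) (b k) (a (suc k))     ∎)
      where
      open ≡-Reasoning
      t q : ℕ → ℕ
      t = seps T
      q = separators P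
      repQ : Represents q Q
      repQ = ≈-represents P≈Q (separators-represent P)
      counts : ∀ n → Boundary n → ones q n ≡ twos t n × twos q n ≡ ones t n
      counts = proj₂ (norm-invariants T (separators-represent P) path)
      b-ok : Boundary (b k)
      b-ok = b-boundary tight k k≤r
      a-ok : Boundary (a (suc k))
      a-ok = a-boundary tight k k≤r

    RPP-unique : ∀ (T U : RPP¹² s ν) →
      (∀ k → k ≤ r → #pure one (table T) (b k) (a (suc k)) ≡ #pure one (table U) (b k) (a (suc k))) →
      table T ≈ᵗ table U
    RPP-unique T U same = separators-≈ (represents T) (represents U)
      (decreasing-unique (valid (represents T)) (valid (represents U)) (seps-rows T) (seps-rows U)
        (seps-decreasing T) (seps-decreasing U) blocks)
      where
      t u : ℕ → ℕ
      t = seps T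
      u = seps U
      block : ∀ {c} → Covered d c → Block t u c
      block {c} (k , k≤r , b≤c , c<a) = record
        { left = b k ; right = a (suc k) ; left≤ = b≤c ; <right = c<a
        ; untight = λ j b≤j j<a → components-untight d components (k , k≤r , b≤j , j<a)
        ; balanced = begin
            ones t (a (suc k)) + ones u (b k)      ≡⟨ cong (_+ ones u (b k)) (#pure-one (represents T) (b≤a k k≤r)) ⟨
            (ones t (b k) + #T) + ones u (b k)     ≡⟨ +-comm _ (ones u (b k)) ⟩
            ones u (b k) + (ones t (b k) + #T)     ≡⟨ cong (ones u (b k) +_) (+-comm (ones t (b k)) #T) ⟩
            ones u (b k) + (#T + ones t (b k))     ≡⟨ +-assoc (ones u (b k)) #T (ones t (b k)) ⟨
            (ones u (b k) + #T) + ones t (b k)     ≡⟨ cong (λ x → (ones u (b k) + x) + ones t (b k)) (same k k≤r) ⟩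
            (ones u (b k) + #U) + ones t (b k)     ≡⟨ cong (_+ ones t (b k)) (#pure-one (represents U) (b≤a k k≤r)) ⟩
            ones u (a (suc k)) + ones t (b k)      ∎
        }
        where
        open ≡-Reasoning
        #T #U : ℕ
        #T = #pure one (table T) (b k) (a (suc k))
        #U = #pure one (table U) (b k) (a (suc k))
      blocks : Blocks t u
      -- The component that contains `c` serves as its block.
      blocks c col ¬tight = block (untight-covered tight (proj₁ (column-range col)) (column<N col) ¬tight)

    -- The common source of the uniqueness of normal forms, of congruence, of involutivity and of
    -- the uniqueness of the map: each time a candidate is seen to have the 1-pure counts of
    -- `image T`.
    norm-unique : ∀ (T U : RPP¹² s ν) →
      (∀ k → k ≤ r → #pure one (table U) (b k) (a (suc k)) ≡ #pure two (table T) (b k) (a (suc k))) →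
      table U ≈ᵗ table (image T)
    norm-unique T U same = RPP-unique U (image T) λ k k≤r →
      trans (same k k≤r) (sym (proj₁ (norm-interchanges T (image-norm T) k k≤r)))

  -- Congruence and the description of the map as `norm` after `flip` mention no cuts; the canonical
  -- ones are supplied here.
  open WithCuts canonicalCuts canonicalCuts-components using (norm-unique; norm-interchanges)

  -- The normal forms of `T` and `U` are reached along separately constructed paths. They agree
  -- because their counts depend only on the tables as maps on cells.
  image-cong : ∀ {T U : RPP¹² s ν} → table T ≈ᵗ table U → table (image T) ≈ᵗ table (image U)
  image-cong {T} {U} T≈U = norm-unique U (image T) λ k k≤r →
    trans (proj₁ (norm-interchanges T (image-norm T) k k≤r))
          (proj₂ (#pure-≈ T≈U (CutBounds.b≤a canonicalCuts k k≤r)))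

  B : RPP-map s ν
  B = record { to = image ; cong = λ {T} {U} → image-cong {T} {U} }

  B-isBenderKnuth : IsBenderKnuth B
  B-isBenderKnuth T Q = mk⇔
    (λ norm → norm-unique T (norm-RPP T {Q} norm) (λ k k≤r → proj₁ (norm-interchanges T {Q} norm k k≤r)))
    -- Conversely, being a normal form is carried along `≈ᵗ`, as `Norm` requires the end of the path
    -- only up to `≈ᵗ`.
    λ Q≈BT → let rpp , P , path , P≈BT = image-norm T in
      (λ i j j′ c c′ j≤j′ → subst₂ _⊑_ (sym (Q≈BT i j c)) (sym (Q≈BT i j′ c′)) (rpp i j j′ c c′ j≤j′)) ,
      P , path , λ i j c → trans (P≈BT i j c) (sym (Q≈BT i j c))

  module _ (d : Cuts s) (components : CutsIntoComponents ν d) where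

    private
      module D = WithCuts d components

    B-interchanges : InterchangesPureCounts d B
    B-interchanges T = D.norm-interchanges T (image-norm T)

    -- In each component `T` has as many 1-pure columns as `image T` has 2-pure ones, and this
    -- characterises `image (image T)`.
    B-involutive : Involution B
    B-involutive T i j c = sym (D.norm-unique (image T) T (λ k k≤r → sym (proj₂ (B-interchanges T k k≤r))) i j c)

    B-unique : ∀ (f : RPP-map s ν) → Involution f × InterchangesPureCounts d f →
               ∀ T → table (Func.to f T) ≈ᵗ table (image T)
    B-unique f (_ , interchanges) T = D.norm-unique T (Func.to f T) λ k k≤r → proj₁ (interchanges T k k≤r)

corollary7p11 : (s : SkewPartition) → Connected s → NoEmptyColumns s →
    (ν : Partition) → Representable s ν →
    Σ (RPP-map s ν) λ B →
    IsBenderKnuth B ×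
    (∃ λ (d : Cuts s) → CutsIntoComponents ν d) ×
    ((d : Cuts s) → CutsIntoComponents ν d →
    (Involution B × InterchangesPureCounts d B) ×
    ((f : RPP-map s ν) → Involution f × InterchangesPureCounts d f →
    ∀ T → table (Func.to f T) ≈ᵗ table (Func.to B T)))
corollary7p11 s connected noEmpty ν representable =
  B , B-isBenderKnuth , (canonicalCuts , canonicalCuts-components) ,
  λ d components → (B-involutive d components , B-interchanges d components) , B-unique d components
  where
  open Components s connected noEmpty ν representable
  open BenderKnuth s connected noEmpty ν representable
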